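{- For every simple polytope $P\subset\mathbb{R}^d$ there is a perturbation $P'$ of $P$, combinatorially isomorphic to $P$, such that for any memory-less pivot rule there is a normalized-weight pivot rule (NW-rule) that produces the same arborescence as the given rule for $(P',c)$, for every generic objective function $c$.
   Context: For a polytope $P\subset\mathbb{R}^d$, $V(P)$ denotes its vertex set and $E(P)$ its edges. A $k$-dimensional polytope is simple if every vertex is incident to exactly $k$ edges. A perturbation of $P=\{x : Ax\le b\}$ is meant in the usual informal sense of a polytope obtained by slightly changing the defining data, e.g. $\{x : (A+\varepsilon A')x\le b\}$ for a matrix $A'$ and some $\varepsilon>0$. A linear function $c\in\mathbb{R}^d$ is generic for $P$ if $c^tu\neq c^tv$ for all edges $uv\in E(P)$; then $c$ has a unique maximizing vertex $v_{opt}$, and $(P,c)$ is called a linear program. For $v\in V(P)$, $\mathrm{Nb}_{P,c}(v)=\{u : uv\in E(P),\ c^tu>c^tv\}$ is the set of $c$-improving neighbors. A $c$-arborescence is a map $\mathcal{A}:V(P)\to V(P)$ with $\mathcal{A}(v)=v$ if and only if $v=v_{opt}$, and $\mathcal{A}(v)\in \mathrm{Nb}_{P,c}(v)$ for all $v\neq v_{opt}$. A pivot rule chooses, at each non-optimal vertex reached by the simplex method on $(P,c)$, a $c$-improving neighbor to move to. It is memory-less if, for every linear program $(P,c)$, the union of all $c$-monotone paths it produces (over all starting vertices) is a directed tree with root $v_{opt}$; equivalently, it is given by a choice of a $c$-arborescence for every linear program $(P,c)$, the arborescence it produces for $(P,c)$. An NW-rule is a choice, for every linear program $(P,c)$, of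 a normalization $\eta:\mathbb{R}^d\to\mathbb{R}$ and a weight $w\in\mathbb{R}^d$ (both may depend on $(P,c)$); the arborescence it produces for $(P,c)$ is the map fixing $v_{opt}$ and sending $v\neq v_{opt}$ to $$\operatorname{argmax}\left\{\frac{w^t(u-v)}{\eta(u-v)} : u\in \mathrm{Nb}_{P,c}(v)\right\}.$$ -}

module Defs where

open import Algebra.Core using (Op₁; Op₂)
open import Algebra.Structures using (IsCommutativeRing)
open import Data.Fin.Base using (Fin)
open import Data.Nat.Base as ℕ using (ℕ; suc)
open import Data.Product.Base using (_×_; ∃; ∃-syntax; Σ-syntax)
open import Data.Refinement.Base using (Refinement-syntax; value)
open import Data.Vec.Base using (Vec; foldr′; lookup; map; replicate; zipWith)
open import Function.Bundles using (_⇔_; _↔_)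
open import Level using (0ℓ)
open import Relation.Binary.Core using (Rel)
open import Relation.Binary.Morphism.Structures using (IsOrderIsomorphism)
open import Relation.Binary.PropositionalEquality.Core using (_≡_; _≢_)
open import Relation.Binary.Structures using (IsTotalOrder)
open import Relation.Nullary.Negation.Core using (¬_)
open import Relation.Unary using (Pred; Satisfiable)

-- The real numbers, given by their characterisation (unique up to
-- isomorphism) as a Dedekind-complete ordered field.
record Reals : Set₁ where
  infix  4 _≤_ _<_
  infixl 6 _+_ _-_
  infixl 7 _*_ _÷_
  infix  8 -_
  infix  9 _⁻¹
  field
    Carrier           : Set
    _+_ _*_           : Op₂ Carrier
    -_                : Op₁ Carrier
    0# 1#             : Carrier
    isCommutativeRing : IsCommutativeRing _≡_ _+_ _*_ -_ 0# 1#
    0≢1               : 0# ≢ 1#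
    -- Total for convenience: nothing is assumed about 0# ⁻¹.
    _⁻¹               : Op₁ Carrier
    *-inverseʳ        : ∀ x → x ≢ 0# → x * x ⁻¹ ≡ 1#
    _≤_               : Rel Carrier 0ℓ
    isTotalOrder      : IsTotalOrder _≡_ _≤_
    +-monoˡ-≤         : ∀ z {x y} → x ≤ y → x + z ≤ y + z
    *-nonNegative     : ∀ {x y} → 0# ≤ x → 0# ≤ y → 0# ≤ x * y

  UpperBound : Pred Carrier 0ℓ → Carrier → Set
  UpperBound S b = ∀ x → S x → x ≤ b

  field
    complete : (S : Pred Carrier 0ℓ) → Satisfiable S → ∃ (UpperBound S) →
               ∃[ s ] (UpperBound S s × (∀ b → UpperBound S b → s ≤ b))

  _<_ : Rel Carrier 0ℓ
  x < y = x ≤ y × x ≢ y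

  _-_ _÷_ : Op₂ Carrier
  x - y = x + (- y)
  x ÷ y = x * y ⁻¹

module LinearProgramming (ℝ : Reals) where
  open Reals ℝ

  Vector : ℕ → Set
  Vector d = Vec Carrier d

  Matrix : ℕ → ℕ → Set
  Matrix m d = Vec (Vector d) m

  infixl 6 _⊕_ _⊖_
  infixl 7 _•_ _∙_

  𝟎 : ∀ {d} → Vector d
  𝟎 {d} = replicate d 0#

  _⊕_ _⊖_ : ∀ {d} → Vector d → Vector d → Vector d
  _⊕_ = zipWith _+_
  _⊖_ = zipWith _-_

  _•_ : ∀ {d} → Carrier → Vector d → Vector d
  t • x = map (t *_) x

  sum : ∀ {d} → Vector d → Carrier
  sum = foldr′ _+_ 0#

  -- cᵗ x
  _∙_ : ∀ {d} → Vector d → Vector d → Carrier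
  c ∙ x = sum (zipWith _*_ c x)

  combination : ∀ {n d} → Vector n → Vec (Vector d) n → Vector d
  combination λs ps = foldr′ _⊕_ 𝟎 (zipWith _•_ λs ps)

  ----------------------------------------------------------------------
  -- Polytopes

  Feasible : ∀ {m d} → Matrix m d → Vector m → Pred (Vector d) 0ℓ
  Feasible A b x = ∀ i → lookup A i ∙ x ≤ lookup b i

  -- A nonempty polytope { x ∈ ℝᵈ : A x ≤ b }.  The inequalities are kept as
  -- part of the polytope because perturbations act on them; they need not be
  -- irredundant, and the polytope need not be full-dimensional.
  record Polytope (m d : ℕ) : Set where
    field
      A        : Matrix m d
      b        : Vector m
      nonempty : Satisfiable (Feasible A b)
      bounded  : ∃[ M ] (∀ x → Feasible A b x →
                           ∀ j → - M ≤ lookup x j × lookup x j ≤ M)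

  open Polytope public using (A; b)

  infix 4 _∈ᴾ_

  _∈ᴾ_ : ∀ {m d} → Vector d → Polytope m d → Set
  x ∈ᴾ P = Feasible (A P) (b P) x

  module _ {m d : ℕ} where

    infix 4 _∈ꟳ_ _⊑_ _≋_

    -- A face is the set of points of P where a valid inequality is tight.
    -- The zero normal gives the faces P and ∅.
    record Face (P : Polytope m d) : Set where
      field
        normal : Vector d
        offset : Carrier
        valid  : ∀ x → x ∈ᴾ P → normal ∙ x ≤ offset

    _∈ꟳ_ : {P : Polytope m d} → Vector d → Face P → Set
    _∈ꟳ_ {P} x F = x ∈ᴾ P × Face.normal F ∙ x ≡ Face.offset F

    -- Different inequalities can define the same face, so faces are compared
    -- as point sets.
    _⊑_ _≋_ : {P : Polytope m d} → Rel (Face P) 0ℓ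
    F ⊑ G = ∀ x → x ∈ꟳ F → x ∈ꟳ G
    F ≋ G = F ⊑ G × G ⊑ F

    Segment : Vector d → Vector d → Pred (Vector d) 0ℓ
    Segment u v x =
      ∃[ t ] (0# ≤ t × t ≤ 1# × x ≡ (1# - t) • u ⊕ t • v)

    module _ (P : Polytope m d) where

      IsVertex : Pred (Vector d) 0ℓ
      IsVertex v = Σ[ F ∈ Face P ] (∀ x → x ∈ꟳ F ⇔ (x ≡ v))

      -- V(P); the proof component is irrelevant, so that two vertices are
      -- equal exactly when they are the same point.
      Vertex : Set
      Vertex = [ v ∈ Vector d ∣ IsVertex v ]

      -- u v ∈ E(P)
      IsEdge : Rel Vertex 0ℓ
      IsEdge u v = u ≢ v ×
        Σ[ F ∈ Face P ] (∀ x → x ∈ꟳ F ⇔ Segment (value u) (value v) x)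

      -- The edges incident to v, each represented by its other endpoint.
      IncidentEdge : Vertex → Set
      IncidentEdge v = [ u ∈ Vertex ∣ IsEdge v u ]

  AffinelyIndependent : ∀ {n d} → Vec (Vector d) n → Set
  AffinelyIndependent {n} ps = (λs : Vector n) →
    sum λs ≡ 0# → combination λs ps ≡ 𝟎 → λs ≡ 𝟎

  module _ {m d : ℕ} (P : Polytope m d) where

    AffinelyIndependentIn : ∀ {n} → Vec (Vector d) n → Set
    AffinelyIndependentIn ps = (∀ i → lookup ps i ∈ᴾ P) × AffinelyIndependent ps

    HasDimension : ℕ → Set
    HasDimension k =
      (∃[ ps ] AffinelyIndependentIn {suc k} ps) ×
      (∀ {n} (ps : Vec (Vector d) n) → AffinelyIndependentIn ps → n ℕ.≤ suc k)

    Simple : Set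
    Simple = ∃[ k ] (HasDimension k × (∀ v → IncidentEdge P v ↔ Fin k))

  infix 4 _≅_

  -- Combinatorial isomorphism: the posets of faces are isomorphic.
  _≅_ : ∀ {m d m′ d′} → Polytope m d → Polytope m′ d′ → Set
  P ≅ Q = ∃[ f ] IsOrderIsomorphism
    (_≋_ {P = P}) (_≋_ {P = Q}) (_⊑_ {P = P}) (_⊑_ {P = Q}) f

  -- ∣ x - y ∣ ≤ δ
  Within : Carrier → Rel Carrier 0ℓ
  Within δ x y = x ≤ y + δ × y ≤ x + δ

  -- P′ arises by changing each entry of the data A, b of P by at most δ.
  Perturbation : ∀ {m d} → Carrier → Rel (Polytope m d) 0ℓ
  Perturbation δ P P′ =
    (∀ i j → Within δ (lookup (lookup (A P′) i) j) (lookup (lookup (A P) i) j)) ×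
    (∀ i   → Within δ (lookup (b P′) i) (lookup (b P) i))

  ----------------------------------------------------------------------
  -- Linear programs and pivot rules

  module _ {m d : ℕ} (P : Polytope m d) (c : Vector d) where

    Generic : Set
    Generic = ∀ u v → IsEdge P u v → c ∙ value u ≢ c ∙ value v

    -- For generic c this says v = v_opt.
    IsOptimal : Pred (Vertex P) 0ℓ
    IsOptimal v = ∀ x → x ∈ᴾ P → c ∙ x ≤ c ∙ value v

    -- Nb_{P,c}(v), as a predicate on u.
    Nb : Vertex P → Pred (Vertex P) 0ℓ
    Nb v u = IsEdge P u v × c ∙ value v < c ∙ value u

    record Arborescence : Set where
      field
        next      : Vertex P → Vertex P
        fixed     : ∀ v → next v ≡ v ⇔ IsOptimal v
        improving : ∀ v → ¬ IsOptimal v → Nb v (next v)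

    module _ (η : Vector d → Carrier) (w : Vector d) where

      ratio : Vertex P → Vertex P → Carrier
      ratio v u = (w ∙ (value u ⊖ value v)) ÷ η (value u ⊖ value v)

      IsArgmax : Vertex P → Pred (Vertex P) 0ℓ
      IsArgmax v u = Nb v u × (∀ u′ → Nb v u′ → ratio v u′ ≤ ratio v u)

    -- The two conditions say that the quotients are defined and that the
    -- argmax is a single neighbor, without which a normalization and a weight
    -- do not determine an arborescence.
    record NormalizedWeight : Set where
      field
        η         : Vector d → Carrier
        w         : Vector d
        η-nonzero : ∀ v u → Nb v u → η (value u ⊖ value v) ≢ 0#
        no-ties   : ∀ v u u′ → IsArgmax η w v u → IsArgmax η w v u′ → u ≡ u′

    -- The arborescence determined by η and w is the given one.
    Produces : NormalizedWeight → Arborescence → Set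
    Produces N 𝒜 = ∀ v →
      (IsOptimal v → next v ≡ v) × (¬ IsOptimal v → IsArgmax η w v (next v))
      where
      open NormalizedWeight N
      open Arborescence 𝒜

  MemorylessRule : Set
  MemorylessRule = ∀ {m d} (P : Polytope m d) c → Generic P c → Arborescence P c

  NWRule : Set
  NWRule = ∀ {m d} (P : Polytope m d) c → Generic P c → NormalizedWeight P c

{-# OPTIONS --safe #-}

-- If no two directed edges of a polytope have the same edge vector, then for
-- w = c a normalization can be prescribed freely on the improving edges, and
-- any arborescence 𝒜 is produced by letting the quotient be 2 on the edges
-- v 𝒜(v) and 1 on all other improving edges.
--
-- It remains to perturb P so that edge vectors become distinct.  The projective
-- map x ↦ x / (1 + ε rᵗx) carries { A x ≤ b } to { (A + ε b rᵗ) y ≤ b } and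
-- preserves the face lattice.  On the image, 1 - ε rᵗy is the affine function
-- with value 1 / (1 + ε rᵗx) at the image of x, so two equal edge vectors give
-- a relation 1/(1 + ε a₁) + 1/(1 + ε a₂) = 1/(1 + ε a₃) + 1/(1 + ε a₄) between
-- the values aᵢ = rᵗxᵢ at four vertices of P.  If r separates the vertices, such
-- a relation fails for small ε unless the aᵢ agree in pairs.
module Submission where

open import Algebra.Bundles using (CommutativeRing)
import Algebra.Properties.Ring as RingProperties
import Algebra.Properties.Semiring.Mult.TCOptimised as Multiples
import Algebra.Solver.Ring as RingSolver
open import Algebra.Solver.Ring.AlmostCommutativeRing using (_-Raw-AlmostCommutative⟶_; Induced-equivalence; fromCommutativeRing)
open import Algebra.Structures using (IsCommutativeRing)
open import Axiom.ExcludedMiddle using (ExcludedMiddle)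
open import Data.Bool.Base using (Bool; true; false)
open import Data.Fin.Base using (Fin; zero; suc)
open import Data.Integer.Base as ℤ using (ℤ; -[1+_])
import Data.Integer.Properties as ℤ
open import Data.Irrelevant using ([_])
import Data.Maybe.Base as Maybe
open import Data.Nat.Base as ℕ using (ℕ; zero; suc)
import Data.Nat.Properties as ℕ
open import Data.Product.Base using (_×_; _,_; ∃-syntax; Σ-syntax; proj₁; proj₂)
open import Data.Refinement.Base using (value; _,_)
open import Data.Refinement.Properties using (value-injective)
open import Data.Sum.Base using (_⊎_; inj₁; inj₂)
open import Data.Vec.Base as Vec using (Vec; []; _∷_; lookup; tabulate; zipWith)
import Data.Vec.Properties as Vec
open import Function.Base using (_∘_; case_of_)
open import Function.Bundles using (Equivalence; mk⇔)
open import Level using (0ℓ)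
open import Relation.Binary.Definitions using (WeaklyDecidable)
open import Relation.Binary.PropositionalEquality
  using (_≡_; _≢_; refl; sym; trans; cong; cong₂; subst; subst₂; module ≡-Reasoning)
open import Relation.Binary.Structures using (IsTotalOrder)
open import Relation.Nullary.Decidable.Core using (Dec; does; yes; no; dec⇒maybe; recompute)
open import Relation.Nullary.Negation.Core using (¬_; contradiction)
open import Relation.Unary using (Pred)
open import Defs

-- Integer coefficients for the ring solver.

module IntegerCoefficients (R : CommutativeRing 0ℓ 0ℓ) where
  open CommutativeRing R hiding (sym; trans; refl)
  open CommutativeRing R using () renaming (sym to ≈-sym; trans to ≈-trans; refl to ≈-refl)
  open RingProperties ring
  open Multiples semiring using () renaming (_×_ to _×′_; 1+× to 1+×′; ×-homo-+ to ×′-homo-+)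
  open import Relation.Binary.Reasoning.Setoid setoid

  -- Equality of integers is decided by computation, which lets the solver cancel terms. The
  -- optimised multiples make the image of 1 reduce to `1#`, so solver constants agree with literal
  -- ones by `refl`.
  fromℤ : ℤ → Carrier
  fromℤ (ℤ.+ n)  = n ×′ 1#
  fromℤ -[1+ n ] = - (suc n ×′ 1#)

  fromℤ-neg : ∀ i → fromℤ (ℤ.- i) ≈ - fromℤ i
  fromℤ-neg (ℤ.+ zero)  = ≈-sym -0#≈0#
  fromℤ-neg (ℤ.+ suc n) = ≈-refl
  fromℤ-neg -[1+ n ]    = ≈-sym (-‿involutive _)

  cancel-1# : ∀ x y → (x + 1#) - (y + 1#) ≈ x - y
  cancel-1# x y = begin
    (x + 1#) - (y + 1#)       ≈⟨ +-congˡ (-‿anti-homo-+ y 1#) ⟩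
    (x + 1#) + (- 1# - y)     ≈⟨ +-assoc x 1# _ ⟩
    x + (1# + (- 1# - y))     ≈⟨ +-congˡ (+-assoc 1# _ _) ⟨
    x + ((1# - 1#) - y)       ≈⟨ +-congˡ (+-congʳ (-‿inverseʳ 1#)) ⟩
    x + (0# - y)              ≈⟨ +-congˡ (+-identityˡ _) ⟩
    x - y                     ∎

  suc-×′ : ∀ n → suc n ×′ 1# ≈ n ×′ 1# + 1#
  suc-×′ n = ≈-trans (1+×′ n 1#) (+-comm 1# _)

  fromℤ-⊖ : ∀ m n → fromℤ (m ℤ.⊖ n) ≈ m ×′ 1# - n ×′ 1#
  fromℤ-⊖ m zero = begin
    m ×′ 1#       ≈⟨ +-identityʳ _ ⟨
    m ×′ 1# + 0#  ≈⟨ +-congˡ -0#≈0# ⟨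
    m ×′ 1# - 0#  ∎
  fromℤ-⊖ zero (suc n) = ≈-sym (+-identityˡ _)
  fromℤ-⊖ (suc m) (suc n) = begin
    fromℤ (suc m ℤ.⊖ suc n)           ≡⟨ cong fromℤ (ℤ.[1+m]⊖[1+n]≡m⊖n m n) ⟩
    fromℤ (m ℤ.⊖ n)                   ≈⟨ fromℤ-⊖ m n ⟩
    m ×′ 1# - n ×′ 1#                 ≈⟨ cancel-1# _ _ ⟨
    (m ×′ 1# + 1#) - (n ×′ 1# + 1#)   ≈⟨ +-cong (suc-×′ m) (-‿cong (suc-×′ n)) ⟨
    suc m ×′ 1# - suc n ×′ 1#         ∎

  fromℤ-+ : ∀ i j → fromℤ (i ℤ.+ j) ≈ fromℤ i + fromℤ j
  fromℤ-+ (ℤ.+ m)  (ℤ.+ n)  = ×′-homo-+ 1# m n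
  fromℤ-+ (ℤ.+ m)  -[1+ n ] = fromℤ-⊖ m (suc n)
  fromℤ-+ -[1+ m ] (ℤ.+ n)  = ≈-trans (fromℤ-⊖ n (suc m)) (+-comm _ _)
  fromℤ-+ -[1+ m ] -[1+ n ] = begin
    - (suc (suc (m ℕ.+ n)) ×′ 1#)         ≡⟨ cong (λ k → - (suc k ×′ 1#)) (ℕ.+-suc m n) ⟨
    - ((suc m ℕ.+ suc n) ×′ 1#)           ≈⟨ -‿cong (×′-homo-+ 1# (suc m) (suc n)) ⟩
    - (suc m ×′ 1# + suc n ×′ 1#)         ≈⟨ -‿+-comm _ _ ⟨
    - (suc m ×′ 1#) - suc n ×′ 1#         ∎

  fromℤ-+* : ∀ m j → fromℤ (ℤ.+ m ℤ.* j) ≈ m ×′ 1# * fromℤ j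
  fromℤ-+* zero j = ≈-sym (zeroˡ _)
  fromℤ-+* (suc m) j = begin
    fromℤ (ℤ.+ suc m ℤ.* j)               ≡⟨ cong fromℤ (ℤ.suc-* (ℤ.+ m) j) ⟩
    fromℤ (j ℤ.+ ℤ.+ m ℤ.* j)             ≈⟨ fromℤ-+ j (ℤ.+ m ℤ.* j) ⟩
    fromℤ j + fromℤ (ℤ.+ m ℤ.* j)         ≈⟨ +-cong (≈-sym (*-identityˡ _)) (fromℤ-+* m j) ⟩
    1# * fromℤ j + m ×′ 1# * fromℤ j      ≈⟨ distribʳ _ _ _ ⟨
    (1# + m ×′ 1#) * fromℤ j              ≈⟨ *-congʳ (1+×′ m 1#) ⟨
    suc m ×′ 1# * fromℤ j                 ∎

  fromℤ-* : ∀ i j → fromℤ (i ℤ.* j) ≈ fromℤ i * fromℤ j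
  fromℤ-* (ℤ.+ m)  j = fromℤ-+* m j
  fromℤ-* -[1+ m ] j = begin
    fromℤ (-[1+ m ] ℤ.* j)          ≡⟨ cong fromℤ (ℤ.neg-distribˡ-* (ℤ.+ suc m) j) ⟨
    fromℤ (ℤ.- (ℤ.+ suc m ℤ.* j))   ≈⟨ fromℤ-neg (ℤ.+ suc m ℤ.* j) ⟩
    - fromℤ (ℤ.+ suc m ℤ.* j)       ≈⟨ -‿cong (fromℤ-+* (suc m) j) ⟩
    - (suc m ×′ 1# * fromℤ j)       ≈⟨ -‿distribˡ-* _ _ ⟩
    - (suc m ×′ 1#) * fromℤ j       ∎

  private
    homomorphism : ℤ.+-*-rawRing -Raw-AlmostCommutative⟶ fromCommutativeRing R
    homomorphism = record
      { ⟦_⟧    = fromℤ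
      ; +-homo = fromℤ-+
      ; *-homo = fromℤ-*
      ; -‿homo = fromℤ-neg
      ; 0-homo = ≈-refl
      ; 1-homo = ≈-refl
      }

    _≟_ : WeaklyDecidable (Induced-equivalence homomorphism)
    i ≟ j = Maybe.map (λ { refl → ≈-refl }) (dec⇒maybe (i ℤ.≟ j))

  open RingSolver ℤ.+-*-rawRing (fromCommutativeRing R) homomorphism _≟_ public

-- Arithmetic of an ordered field.

module OrderedField (em : ExcludedMiddle 0ℓ) (ℝ : Reals) where
  open Reals ℝ
  open IsTotalOrder isTotalOrder public using (total)
    renaming (refl to ≤-refl; reflexive to ≤-reflexive; trans to ≤-trans; antisym to ≤-antisym)
  open IsCommutativeRing isCommutativeRing public
    using (+-comm; +-identityˡ; +-identityʳ; *-comm; *-identityˡ; *-identityʳ; zeroˡ; zeroʳ)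

  commutativeRing : CommutativeRing 0ℓ 0ℓ
  commutativeRing = record { isCommutativeRing = isCommutativeRing }

  open IntegerCoefficients commutativeRing public
    using (Polynomial; solve; _:+_; _:-_; _:*_; :-_; _:=_; con)

  :0 :1 :2 : ∀ {n} → Polynomial n
  :0 = con (ℤ.+ 0)
  :1 = con (ℤ.+ 1)
  :2 = :1 :+ :1

  2# : Carrier
  2# = 1# + 1#

  x-x≡0 : ∀ x → x - x ≡ 0#
  x-x≡0 = solve 1 (λ x → x :- x := :0) refl

  x-y≡0⇒x≡y : ∀ {x y} → x - y ≡ 0# → x ≡ y
  x-y≡0⇒x≡y {x} {y} eq = begin
    x              ≡⟨ solve 2 (λ x y → x := (x :- y) :+ y) refl x y ⟩
    (x - y) + y    ≡⟨ cong (_+ y) eq ⟩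
    0# + y         ≡⟨ +-identityˡ y ⟩
    y              ∎
    where open ≡-Reasoning

  0≤y-x⇒x≤y : ∀ {x y} → 0# ≤ y - x → x ≤ y
  0≤y-x⇒x≤y {x} {y} p = subst₂ _≤_ (+-identityˡ x)
    (solve 2 (λ x y → (y :- x) :+ x := y) refl x y) (+-monoˡ-≤ x p)

  x≤y⇒0≤y-x : ∀ {x y} → x ≤ y → 0# ≤ y - x
  x≤y⇒0≤y-x {x} p = subst (_≤ _) (x-x≡0 x) (+-monoˡ-≤ (- x) p)

  -- Inequalities are proved by exhibiting a nonnegative quantity and leaving
  -- the identity to the ring solver.
  ≤-by : ∀ {x y e} → 0# ≤ e → e ≡ y - x → x ≤ y
  ≤-by p eq = 0≤y-x⇒x≤y (subst (0# ≤_) eq p)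

  +-nonNegative : ∀ {x y} → 0# ≤ x → 0# ≤ y → 0# ≤ x + y
  +-nonNegative {x} {y} p q = ≤-trans q (≤-by p
    (solve 2 (λ x y → x := (x :+ y) :- y) refl x y))

  +-mono-≤ : ∀ {x y u v} → x ≤ y → u ≤ v → x + u ≤ y + v
  +-mono-≤ {x} {y} {u} {v} p q = ≤-by (+-nonNegative (x≤y⇒0≤y-x p) (x≤y⇒0≤y-x q))
    (solve 4 (λ x y u v → (y :- x) :+ (v :- u) := (y :+ v) :- (x :+ u)) refl x y u v)

  *-monoˡ-≤ : ∀ {x y z} → 0# ≤ z → x ≤ y → z * x ≤ z * y
  *-monoˡ-≤ {x} {y} {z} p q = ≤-by (*-nonNegative p (x≤y⇒0≤y-x q))
    (solve 3 (λ x y z → z :* (y :- x) := z :* y :- z :* x) refl x y z)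

  neg-nonNegative : ∀ {x} → x ≤ 0# → 0# ≤ - x
  neg-nonNegative {x} p = subst (0# ≤_) (+-identityˡ (- x)) (x≤y⇒0≤y-x p)

  ≤∨> : ∀ x y → x ≤ y ⊎ y < x
  ≤∨> x y with em {x ≤ y}
  ... | yes p = inj₁ p
  ... | no ¬p with total x y
  ...   | inj₁ p = inj₁ p
  ...   | inj₂ q = inj₂ (q , λ { refl → ¬p q })

  <⇒≱ : ∀ {x y} → x < y → ¬ (y ≤ x)
  <⇒≱ (p , x≢y) q = x≢y (≤-antisym p q)

  0<1 : 0# < 1#
  0<1 with total 0# 1#
  ... | inj₁ p = p , 0≢1
  -- If 1 ≤ 0, then 1 = (-1)(-1) is still a product of nonnegative numbers.
  ... | inj₂ q = subst (0# ≤_) (solve 0 (:- :1 :* :- :1 := :1) refl)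
                   (*-nonNegative (neg-nonNegative q) (neg-nonNegative q)) , 0≢1

  0≤1 : 0# ≤ 1#
  0≤1 = proj₁ 0<1

  x<x+1 : ∀ {x} → x < x + 1#
  x<x+1 {x} = ≤-by 0≤1 (solve 1 (λ x → :1 := (x :+ :1) :- x) refl x) ,
    λ eq → 0≢1 (begin
      0#             ≡⟨ x-x≡0 x ⟨
      x - x          ≡⟨ cong (_- x) eq ⟩
      (x + 1#) - x   ≡⟨ solve 1 (λ x → (x :+ :1) :- x := :1) refl x ⟩
      1#             ∎)
    where open ≡-Reasoning

  1<2 : 1# < 2#
  1<2 = x<x+1

  <-≤-trans : ∀ {x y z} → x < y → y ≤ z → x < z
  <-≤-trans x<y@(p , _) q = ≤-trans p q , λ { refl → <⇒≱ x<y q }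

  0<2 : 0# < 2#
  0<2 = <-≤-trans 0<1 (proj₁ 1<2)

  *-cancelˡ : ∀ {x y z} → z ≢ 0# → z * x ≡ z * y → x ≡ y
  *-cancelˡ {x} {y} {z} z≢0 eq = begin
    x                  ≡⟨ *-identityˡ x ⟨
    1# * x             ≡⟨ cong (_* x) (*-inverseʳ z z≢0) ⟨
    z * z ⁻¹ * x       ≡⟨ rearrange x ⟩
    z ⁻¹ * (z * x)     ≡⟨ cong (z ⁻¹ *_) eq ⟩
    z ⁻¹ * (z * y)     ≡⟨ rearrange y ⟨
    z * z ⁻¹ * y       ≡⟨ cong (_* y) (*-inverseʳ z z≢0) ⟩
    1# * y             ≡⟨ *-identityˡ y ⟩
    y                  ∎
    where
    open ≡-Reasoning
    rearrange : ∀ x → z * z ⁻¹ * x ≡ z ⁻¹ * (z * x)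
    rearrange = solve 3 (λ z z′ x → z :* z′ :* x := z′ :* (z :* x)) refl z (z ⁻¹)

  *-zero-product : ∀ {x y} → x * y ≡ 0# → x ≡ 0# ⊎ y ≡ 0#
  *-zero-product {x} {y} eq with em {x ≡ 0#}
  ... | yes x≡0 = inj₁ x≡0
  ... | no x≢0  = inj₂ (*-cancelˡ x≢0 (trans eq (sym (zeroʳ x))))

  *-≢0 : ∀ {x y} → x ≢ 0# → y ≢ 0# → x * y ≢ 0#
  *-≢0 x≢0 y≢0 eq with *-zero-product eq
  ... | inj₁ x≡0 = x≢0 x≡0
  ... | inj₂ y≡0 = y≢0 y≡0

  >⇒≢ : ∀ {x y} → x < y → y ≢ x
  >⇒≢ (_ , x≢y) y≡x = x≢y (sym y≡x)

  *-positive : ∀ {x y} → 0# < x → 0# < y → 0# < x * y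
  *-positive 0<x 0<y = *-nonNegative (proj₁ 0<x) (proj₁ 0<y) ,
    λ eq → *-≢0 (>⇒≢ 0<x) (>⇒≢ 0<y) (sym eq)

  *-cancelˡ-≤ : ∀ {x y z} → 0# < z → z * x ≤ z * y → x ≤ y
  *-cancelˡ-≤ {x} {y} {z} 0<z p with ≤∨> x y
  ... | inj₁ x≤y = x≤y
  ... | inj₂ (y≤x , y≢x) with () ← y≢x (*-cancelˡ (>⇒≢ 0<z) (≤-antisym (*-monoˡ-≤ (proj₁ 0<z) y≤x) p))

  positive-cofactor : ∀ {x y} → 0# < x → 0# < x * y → 0# < y
  positive-cofactor {x} {y} 0<x (p , q) =
    *-cancelˡ-≤ 0<x (subst (_≤ x * y) (sym (zeroʳ x)) p) ,
    λ { refl → q (sym (zeroʳ x)) }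

  ⁻¹-positive : ∀ {x} → 0# < x → 0# < x ⁻¹
  ⁻¹-positive {x} 0<x = positive-cofactor 0<x (subst (0# <_) (sym (*-inverseʳ x (>⇒≢ 0<x))) 0<1)

  x<y⇒0<y-x : ∀ {x y} → x < y → 0# < y - x
  x<y⇒0<y-x (p , x≢y) = x≤y⇒0≤y-x p , λ eq → x≢y (sym (x-y≡0⇒x≡y (sym eq)))

  -- Properties of all sufficiently small positive scalars.

  minimum : ∀ x y → ∃[ z ] ((z ≡ x ⊎ z ≡ y) × z ≤ x × z ≤ y)
  minimum x y with total x y
  ... | inj₁ p = x , inj₁ refl , ≤-refl , p
  ... | inj₂ p = y , inj₂ refl , p , ≤-refl

  -- Every smallness requirement on a parameter takes this form, so that finitely many of them can
  -- be combined before `ev-witness` extracts one concrete value.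
  Eventually : Pred Carrier 0ℓ → Set
  Eventually Q = ∃[ ε₀ ] (0# < ε₀ × (∀ ε → 0# < ε → ε ≤ ε₀ → Q ε))

  module _ {Q R : Pred Carrier 0ℓ} where

    ev-map : (∀ ε → 0# < ε → Q ε → R ε) → Eventually Q → Eventually R
    ev-map f (ε₀ , 0<ε₀ , q) = ε₀ , 0<ε₀ , λ ε 0<ε ε≤ → f ε 0<ε (q ε 0<ε ε≤)

    ev-× : Eventually Q → Eventually R → Eventually (λ ε → Q ε × R ε)
    ev-× (α , 0<α , q) (β , 0<β , r) with minimum α β
    ... | γ , γ≡ , γ≤α , γ≤β = γ , positive γ≡ ,
      λ ε 0<ε ε≤γ → q ε 0<ε (≤-trans ε≤γ γ≤α) , r ε 0<ε (≤-trans ε≤γ γ≤β)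
      where
      positive : γ ≡ α ⊎ γ ≡ β → 0# < γ
      positive (inj₁ refl) = 0<α
      positive (inj₂ refl) = 0<β

  ev-always : {Q : Pred Carrier 0ℓ} → (∀ ε → 0# < ε → Q ε) → Eventually Q
  ev-always q = 1# , 0<1 , λ ε 0<ε _ → q ε 0<ε

  ev-witness : {Q : Pred Carrier 0ℓ} → Eventually Q → ∃[ ε ] (0# < ε × Q ε)
  ev-witness (ε₀ , 0<ε₀ , q) = ε₀ , 0<ε₀ , q ε₀ 0<ε₀ ≤-refl

  ev-∀Fin : ∀ {n} {Q : Fin n → Pred Carrier 0ℓ} →
            (∀ i → Eventually (Q i)) → Eventually (λ ε → ∀ i → Q i ε)
  ev-∀Fin {zero}  q = ev-always λ _ _ ()
  ev-∀Fin {suc n} q = ev-map (λ { _ _ (p , r) zero → p ; _ _ (p , r) (suc i) → r i })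
    (ev-× (q zero) (ev-∀Fin λ i → q (suc i)))

  ev-∀Bits : ∀ {n} {Q : Vec Bool n → Pred Carrier 0ℓ} →
             (∀ s → Eventually (Q s)) → Eventually (λ ε → ∀ s → Q s ε)
  ev-∀Bits {zero}  q = ev-map (λ { _ _ p [] → p }) (q [])
  ev-∀Bits {suc n} q = ev-map
    (λ { _ _ (p , r) (false ∷ s) → p s ; _ _ (p , r) (true ∷ s) → r s })
    (ev-× (ev-∀Bits λ s → q (false ∷ s)) (ev-∀Bits λ s → q (true ∷ s)))

  ev-*-≤ : ∀ x {δ} → 0# < δ → Eventually (λ ε → ε * x ≤ δ)
  ev-*-≤ x {δ} 0<δ with ≤∨> x 0#
  ... | inj₁ x≤0 = ev-always λ ε 0<ε → ≤-trans
          (subst (ε * x ≤_) (zeroʳ ε) (*-monoˡ-≤ (proj₁ 0<ε) x≤0)) (proj₁ 0<δ)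
  ... | inj₂ 0<x = δ ÷ x , *-positive 0<δ (⁻¹-positive 0<x) , λ ε _ ε≤ →
          subst₂ _≤_ (*-comm x ε) (eq (>⇒≢ 0<x)) (*-monoˡ-≤ (proj₁ 0<x) ε≤)
    where
    open ≡-Reasoning
    eq : x ≢ 0# → x * (δ ÷ x) ≡ δ
    eq x≢0 = begin
      x * (δ * x ⁻¹)   ≡⟨ solve 3 (λ x x′ δ → x :* (δ :* x′) := (x :* x′) :* δ) refl x (x ⁻¹) δ ⟩
      x * x ⁻¹ * δ     ≡⟨ cong (_* δ) (*-inverseʳ x x≢0) ⟩
      1# * δ           ≡⟨ *-identityˡ δ ⟩
      δ                ∎

  module _ {V : Set} {n : ℕ} (code : V → Vec Bool n) where

    -- A set with an injective code in bit vectors is finite, so "eventually"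
    -- commutes with quantification over it.
    ev-∀ : (∀ {u v} → code u ≡ code v → u ≡ v) → {Q : V → Pred Carrier 0ℓ} →
           (∀ v → Eventually (Q v)) → Eventually (λ ε → ∀ v → Q v ε)
    ev-∀ code-injective {Q} q = ev-map (λ ε 0<ε f v → f (code v) v refl) (ev-∀Bits byCode)
      where
      byCode : ∀ s → Eventually (λ ε → ∀ v → code v ≡ s → Q v ε)
      byCode s with em {∃[ v ] code v ≡ s}
      ... | yes (v , refl) = ev-map (λ ε _ p u eq → subst (λ u → Q u ε) (sym (code-injective eq)) p) (q v)
      ... | no ∄v          = ev-always λ _ _ v eq → contradiction (v , eq) ∄v

-- Inner products, and polynomials near zero.

module Vectors (em : ExcludedMiddle 0ℓ) (ℝ : Reals) where
  open Reals ℝ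
  open OrderedField em ℝ
  open LinearProgramming ℝ

  ∙-⊕ˡ : ∀ {d} (c c′ x : Vector d) → (c ⊕ c′) ∙ x ≡ c ∙ x + c′ ∙ x
  ∙-⊕ˡ [] [] [] = sym (+-identityˡ 0#)
  ∙-⊕ˡ (a ∷ c) (a′ ∷ c′) (t ∷ x) rewrite ∙-⊕ˡ c c′ x =
    solve 5 (λ a a′ t u v → (a :+ a′) :* t :+ (u :+ v) := (a :* t :+ u) :+ (a′ :* t :+ v))
      refl a a′ t (c ∙ x) (c′ ∙ x)

  ∙-•ˡ : ∀ {d} k (c x : Vector d) → (k • c) ∙ x ≡ k * (c ∙ x)
  ∙-•ˡ k [] [] = sym (zeroʳ k)
  ∙-•ˡ k (a ∷ c) (t ∷ x) rewrite ∙-•ˡ k c x =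
    solve 4 (λ k a t u → k :* a :* t :+ k :* u := k :* (a :* t :+ u)) refl k a t (c ∙ x)

  ∙-comm : ∀ {d} (c x : Vector d) → c ∙ x ≡ x ∙ c
  ∙-comm [] [] = refl
  ∙-comm (a ∷ c) (t ∷ x) = cong₂ _+_ (*-comm a t) (∙-comm c x)

  ∙-⊕ʳ : ∀ {d} (c x y : Vector d) → c ∙ (x ⊕ y) ≡ c ∙ x + c ∙ y
  ∙-⊕ʳ c x y rewrite ∙-comm c (x ⊕ y) | ∙-comm c x | ∙-comm c y = ∙-⊕ˡ x y c

  ∙-•ʳ : ∀ {d} k (c x : Vector d) → c ∙ (k • x) ≡ k * (c ∙ x)
  ∙-•ʳ k c x rewrite ∙-comm c (k • x) | ∙-comm c x = ∙-•ˡ k x c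

  ∙-⊖ʳ : ∀ {d} (c x y : Vector d) → c ∙ (x ⊖ y) ≡ c ∙ x - c ∙ y
  ∙-⊖ʳ [] [] [] = sym (x-x≡0 0#)
  ∙-⊖ʳ (a ∷ c) (s ∷ x) (t ∷ y) rewrite ∙-⊖ʳ c x y =
    solve 5 (λ a s t u v → a :* (s :- t) :+ (u :- v) := (a :* s :+ u) :- (a :* t :+ v))
      refl a s t (c ∙ x) (c ∙ y)

  ∙-𝟎 : ∀ {d} (c : Vector d) → c ∙ 𝟎 ≡ 0#
  ∙-𝟎 [] = refl
  ∙-𝟎 (a ∷ c) rewrite ∙-𝟎 c = trans (+-identityʳ _) (zeroʳ a)

  x⊖y≡𝟎⇒x≡y : ∀ {d} (x y : Vector d) → x ⊖ y ≡ 𝟎 → x ≡ y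
  x⊖y≡𝟎⇒x≡y [] [] _ = refl
  x⊖y≡𝟎⇒x≡y (s ∷ x) (t ∷ y) eq =
    cong₂ _∷_ (x-y≡0⇒x≡y (Vec.∷-injectiveˡ eq)) (x⊖y≡𝟎⇒x≡y x y (Vec.∷-injectiveʳ eq))

  lookup≡0⇒≡𝟎 : ∀ {d} (x : Vector d) → (∀ j → lookup x j ≡ 0#) → x ≡ 𝟎
  lookup≡0⇒≡𝟎 [] _ = refl
  lookup≡0⇒≡𝟎 (t ∷ x) eq = cong₂ _∷_ (eq zero) (lookup≡0⇒≡𝟎 x λ j → eq (suc j))

  lookup-⊕-• : ∀ {d} (x z : Vector d) k j → lookup (x ⊕ k • z) j ≡ lookup x j + k * lookup z j
  lookup-⊕-• x z k j = trans (Vec.lookup-zipWith _+_ j x (k • z)) (cong (lookup x j +_) (Vec.lookup-map j (k *_) z))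

  •-inverseˡ : ∀ {d k l} (x : Vector d) → k * l ≡ 1# → k • (l • x) ≡ x
  •-inverseˡ [] _ = refl
  •-inverseˡ {k = k} {l} (t ∷ x) eq = cong₂ _∷_ (begin
    k * (l * t)   ≡⟨ solve 3 (λ k l t → k :* (l :* t) := k :* l :* t) refl k l t ⟩
    k * l * t     ≡⟨ cong (_* t) eq ⟩
    1# * t        ≡⟨ *-identityˡ t ⟩
    t             ∎) (•-inverseˡ x eq)
    where open ≡-Reasoning

  -- The moment curve (1, τ, τ², ...) in Horner form: pairing with z evaluates at τ the polynomial
  -- with coefficient vector z.
  powers : ∀ d → Carrier → Vector d
  powers zero    τ = []
  powers (suc d) τ = 1# ∷ τ • powers d τ

  powers-∷ : ∀ {d} τ z₀ (z : Vector d) → powers (suc d) τ ∙ (z₀ ∷ z) ≡ z₀ + τ * (powers d τ ∙ z)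
  powers-∷ τ z₀ z = cong₂ _+_ (*-identityˡ z₀) (∙-•ˡ τ (powers _ τ) z)

  -- In Horner form the tail enters multiplied by τ; if it is at most `R`, it contributes at most 1
  -- as soon as τ `R` ≤ 1.
  powers-bounded : ∀ {d} (z : Vector d) → ∃[ R ] Eventually (λ τ → powers d τ ∙ z ≤ R)
  powers-bounded [] = 0# , ev-always λ _ _ → ≤-refl
  powers-bounded (z₀ ∷ z) with powers-bounded z
  ... | R , bounded = z₀ + 1# , ev-map
    (λ τ 0<τ (e≤R , τR≤1) → subst (_≤ z₀ + 1#) (sym (powers-∷ τ z₀ z))
      (+-mono-≤ ≤-refl (≤-trans (*-monoˡ-≤ (proj₁ 0<τ) e≤R) τR≤1)))
    (ev-× bounded (ev-*-≤ R 0<1))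

  square-positive : ∀ {x} → x ≢ 0# → 0# < x * x
  square-positive {x} x≢0 = nonNegative (total 0# x) , λ eq → *-≢0 x≢0 x≢0 (sym eq)
    where
    nonNegative : 0# ≤ x ⊎ x ≤ 0# → 0# ≤ x * x
    nonNegative (inj₁ p) = *-nonNegative p p
    nonNegative (inj₂ p) = subst (0# ≤_) (solve 1 (λ x → :- x :* :- x := x :* x) refl x)
      (*-nonNegative (neg-nonNegative p) (neg-nonNegative p))

  -- A nonzero polynomial has no root in some interval to the right of 0: factor out τ until the
  -- constant coefficient is nonzero, and then that coefficient dominates.
  powers-nonzero : ∀ {d} (z : Vector d) → z ≢ 𝟎 → Eventually (λ τ → powers d τ ∙ z ≢ 0#)
  powers-nonzero [] z≢𝟎 = contradiction refl z≢𝟎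
  powers-nonzero (z₀ ∷ z) z≢𝟎 with em {z₀ ≡ 0#}
  ... | yes refl = ev-map
    (λ τ 0<τ e≢0 eq → *-≢0 (>⇒≢ 0<τ) e≢0
      (trans (sym (+-identityˡ _)) (trans (sym (powers-∷ τ 0# z)) eq)))
    (powers-nonzero z λ { refl → z≢𝟎 refl })
  -- The factor `- z₀` takes care of the sign of `z₀`: at a root, τ times the scaled tail equals
  -- `z₀`², but it is at most τ `R`, which is below τ (`R` + 1) ≤ `z₀`².
  ... | no z₀≢0 with powers-bounded ((- z₀) • z)
  ...   | R , bounded = ev-map
    (λ τ 0<τ (e≤R , small) eq → <⇒≱ x<x+1 (*-cancelˡ-≤ 0<τ (≤-trans small
      (subst (_≤ τ * R) (square τ eq) (*-monoˡ-≤ (proj₁ 0<τ) e≤R)))))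
    (ev-× bounded (ev-*-≤ (R + 1#) (square-positive z₀≢0)))
    where
    open ≡-Reasoning
    square : ∀ τ → powers _ τ ∙ (z₀ ∷ z) ≡ 0# → τ * (powers _ τ ∙ ((- z₀) • z)) ≡ z₀ * z₀
    square τ eq = begin
      τ * (powers _ τ ∙ ((- z₀) • z))    ≡⟨ cong (τ *_) (∙-•ʳ (- z₀) (powers _ τ) z) ⟩
      τ * (- z₀ * e)                     ≡⟨ solve 3 (λ τ z₀ e → τ :* (:- z₀ :* e) := z₀ :* z₀ :- z₀ :* (z₀ :+ τ :* e)) refl τ z₀ e ⟩
      z₀ * z₀ - z₀ * (z₀ + τ * e)        ≡⟨ cong (λ t → z₀ * z₀ - z₀ * t) (trans (sym (powers-∷ τ z₀ z)) eq) ⟩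
      z₀ * z₀ - z₀ * 0#                  ≡⟨ solve 1 (λ z₀ → z₀ :* z₀ :- z₀ :* :0 := z₀ :* z₀) refl z₀ ⟩
      z₀ * z₀                            ∎
      where e = powers _ τ ∙ z

  -- Equal sums of two reciprocals.

  reciprocal-sum : ∀ {s t h k} → s * h ≡ 1# → t * k ≡ 1# → (s + t) * (h * k) ≡ h + k
  reciprocal-sum {s} {t} {h} {k} sh tk = begin
    (s + t) * (h * k)             ≡⟨ solve 4 (λ s t h k → (s :+ t) :* (h :* k) := (s :* h) :* k :+ (t :* k) :* h) refl s t h k ⟩
    (s * h) * k + (t * k) * h     ≡⟨ cong₂ (λ x y → x * k + y * h) sh tk ⟩
    1# * k + 1# * h               ≡⟨ solve 2 (λ h k → :1 :* k :+ :1 :* h := h :+ k) refl h k ⟩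
    h + k                         ∎
    where open ≡-Reasoning

  -- The function ε ↦ Σᵢ ± 1/(1 + ε aᵢ) has its poles at the -1/aᵢ, so it
  -- vanishes for small ε only if the poles cancel in pairs.
  reciprocals-Sidon : ∀ a₁ a₂ a₃ a₄ → Eventually (λ ε → ∀ s₁ s₂ s₃ s₄ →
    s₁ * (1# + ε * a₁) ≡ 1# → s₂ * (1# + ε * a₂) ≡ 1# →
    s₃ * (1# + ε * a₃) ≡ 1# → s₄ * (1# + ε * a₄) ≡ 1# →
    s₁ + s₂ ≡ s₃ + s₄ → (a₁ ≡ a₃ × a₂ ≡ a₄) ⊎ (a₁ ≡ a₄ × a₂ ≡ a₃))
  reciprocals-Sidon a₁ a₂ a₃ a₄ with em {(a₁ ≡ a₃ × a₂ ≡ a₄) ⊎ (a₁ ≡ a₄ × a₂ ≡ a₃)}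
  ... | yes paired = ev-always λ _ _ _ _ _ _ _ _ _ _ _ → paired
  ... | no ¬paired = ev-map
    (λ ε 0<ε p≢0 _ _ _ _ i₁ i₂ i₃ i₄ eq → contradiction (vanishes ε i₁ i₂ i₃ i₄ eq) (*-≢0 (>⇒≢ 0<ε) p≢0))
    (powers-nonzero coefficients coefficients≢𝟎)
    where
    open ≡-Reasoning
    S = a₁ + a₂
    T = a₃ + a₄
    P = a₁ * a₂
    Q = a₃ * a₄
    -- Clearing denominators turns the relation into (h₁ + h₂) h₃ h₄ = (h₃ + h₄) h₁ h₂. The
    -- difference of the sides has no constant term; these are its coefficients in ε after division
    -- by ε.
    coefficients : Vector 3
    coefficients = (T - S) ∷ 2# * (Q - P) ∷ (S * Q - T * P) ∷ []

    -- By Vieta, x is a root of (t - z)(t - w), and the common sum then determines y.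
    same-factor : ∀ {x y z w} → x + y ≡ z + w → x * y ≡ z * w → (x ≡ z × y ≡ w) ⊎ (x ≡ w × y ≡ z)
    same-factor {x} {y} {z} {w} sum≡ prod≡ = case *-zero-product factored of λ where
        (inj₁ eq) → inj₁ (x-y≡0⇒x≡y eq , (begin
          y               ≡⟨ solve 2 (λ x y → y := (x :+ y) :- x) refl x y ⟩
          (x + y) - x     ≡⟨ cong₂ _-_ sum≡ (x-y≡0⇒x≡y eq) ⟩
          (z + w) - z     ≡⟨ solve 2 (λ z w → (z :+ w) :- z := w) refl z w ⟩
          w               ∎))
        (inj₂ eq) → inj₂ (x-y≡0⇒x≡y eq , (begin
          y               ≡⟨ solve 2 (λ x y → y := (x :+ y) :- x) refl x y ⟩
          (x + y) - x     ≡⟨ cong₂ _-_ sum≡ (x-y≡0⇒x≡y eq) ⟩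
          (z + w) - w     ≡⟨ solve 2 (λ z w → (z :+ w) :- w := z) refl z w ⟩
          z               ∎))
      where
      factored : (x - z) * (x - w) ≡ 0#
      factored = begin
        (x - z) * (x - w)                                     ≡⟨ solve 4 (λ x y z w → (x :- z) :* (x :- w) := x :* ((x :+ y) :- (z :+ w)) :- (x :* y :- z :* w)) refl x y z w ⟩
        x * ((x + y) - (z + w)) - (x * y - z * w)             ≡⟨ cong₂ (λ u v → x * (u - (z + w)) - (v - z * w)) sum≡ prod≡ ⟩
        x * ((z + w) - (z + w)) - (z * w - z * w)             ≡⟨ solve 3 (λ x z w → x :* ((z :+ w) :- (z :+ w)) :- (z :* w :- z :* w) := :0) refl x z w ⟩
        0#                                                    ∎

    coefficients≢𝟎 : coefficients ≢ 𝟎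
    -- If the first two coefficients vanish, the pairs have equal sum and equal product, which is
    -- the excluded pairing.
    coefficients≢𝟎 eq with *-zero-product (Vec.∷-injectiveˡ (Vec.∷-injectiveʳ eq))
    ... | inj₁ 2≡0 = >⇒≢ 0<2 2≡0
    ... | inj₂ Q-P≡0 = ¬paired (same-factor
      (sym (x-y≡0⇒x≡y (Vec.∷-injectiveˡ eq))) (sym (x-y≡0⇒x≡y Q-P≡0)))

    module _ ε {s₁ s₂ s₃ s₄}
      (i₁ : s₁ * (1# + ε * a₁) ≡ 1#) (i₂ : s₂ * (1# + ε * a₂) ≡ 1#)
      (i₃ : s₃ * (1# + ε * a₃) ≡ 1#) (i₄ : s₄ * (1# + ε * a₄) ≡ 1#)
      (eq : s₁ + s₂ ≡ s₃ + s₄) where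
      h₁ = 1# + ε * a₁
      h₂ = 1# + ε * a₂
      h₃ = 1# + ε * a₃
      h₄ = 1# + ε * a₄

      cleared : (h₁ + h₂) * (h₃ * h₄) ≡ (h₃ + h₄) * (h₁ * h₂)
      cleared = begin
        (h₁ + h₂) * (h₃ * h₄)                   ≡⟨ cong (_* (h₃ * h₄)) (reciprocal-sum i₁ i₂) ⟨
        (s₁ + s₂) * (h₁ * h₂) * (h₃ * h₄)       ≡⟨ cong (λ t → t * (h₁ * h₂) * (h₃ * h₄)) eq ⟩
        (s₃ + s₄) * (h₁ * h₂) * (h₃ * h₄)       ≡⟨ solve 3 (λ s p q → s :* p :* q := s :* q :* p) refl (s₃ + s₄) (h₁ * h₂) (h₃ * h₄) ⟩
        (s₃ + s₄) * (h₃ * h₄) * (h₁ * h₂)       ≡⟨ cong (_* (h₁ * h₂)) (reciprocal-sum i₃ i₄) ⟩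
        (h₃ + h₄) * (h₁ * h₂)                   ∎

      vanishes : ε * (powers 3 ε ∙ coefficients) ≡ 0#
      vanishes = begin
        ε * (powers 3 ε ∙ coefficients)                     ≡⟨ expand ⟩
        (h₁ + h₂) * (h₃ * h₄) - (h₃ + h₄) * (h₁ * h₂)       ≡⟨ cong (_- (h₃ + h₄) * (h₁ * h₂)) cleared ⟩
        (h₃ + h₄) * (h₁ * h₂) - (h₃ + h₄) * (h₁ * h₂)       ≡⟨ x-x≡0 _ ⟩
        0#                                                  ∎
        where
        expand = solve 5 (λ ε a₁ a₂ a₃ a₄ →
          let h₁ = :1 :+ ε :* a₁; h₂ = :1 :+ ε :* a₂; h₃ = :1 :+ ε :* a₃; h₄ = :1 :+ ε :* a₄
              S = a₁ :+ a₂; T = a₃ :+ a₄; P = a₁ :* a₂; Q = a₃ :* a₄ in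
          ε :* (:1 :* (T :- S) :+ (ε :* :1 :* (:2 :* (Q :- P)) :+
            (ε :* (ε :* :1) :* (S :* Q :- T :* P) :+ :0)))
          := (h₁ :+ h₂) :* (h₃ :* h₄) :- (h₃ :+ h₄) :* (h₁ :* h₂)) refl ε a₁ a₂ a₃ a₄

-- Boundedness, faces and vertices of polytopes.

module Polytopes (em : ExcludedMiddle 0ℓ) (ℝ : Reals) where
  open Reals ℝ
  open OrderedField em ℝ
  open LinearProgramming ℝ
  open Vectors em ℝ

  -- The constant found is `M` times the sum of the absolute values of the coefficients: the sign of
  -- each coefficient selects the side of the box that bounds its term.
  bounded-below : ∀ {d} M (r : Vector d) →
    ∃[ R ] (∀ x → (∀ j → - M ≤ lookup x j × lookup x j ≤ M) → - R ≤ r ∙ x)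
  bounded-below M [] = 0# , λ { [] _ → ≤-by ≤-refl (solve 0 (:0 := :0 :- (:- :0)) refl) }
  bounded-below M (r₀ ∷ r) with bounded-below M r | total 0# r₀
  ... | R , below | inj₁ 0≤r₀ = r₀ * M + R , λ { (t ∷ x) bound → ≤-by
    (+-nonNegative (*-nonNegative 0≤r₀ (x≤y⇒0≤y-x (proj₁ (bound zero))))
                   (x≤y⇒0≤y-x (below x (bound ∘ suc))))
    (solve 5 (λ r₀ M R t e → r₀ :* (t :- :- M) :+ (e :- :- R) := (r₀ :* t :+ e) :- :- (r₀ :* M :+ R))
      refl r₀ M R t (r ∙ x)) }
  ... | R , below | inj₂ r₀≤0 = - r₀ * M + R , λ { (t ∷ x) bound → ≤-by
    (+-nonNegative (*-nonNegative (neg-nonNegative r₀≤0) (x≤y⇒0≤y-x (proj₂ (bound zero))))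
                   (x≤y⇒0≤y-x (below x (bound ∘ suc))))
    (solve 5 (λ r₀ M R t e → :- r₀ :* (M :- t) :+ (e :- :- R) := (r₀ :* t :+ e) :- :- (:- r₀ :* M :+ R))
      refl r₀ M R t (r ∙ x)) }

  unbounded : ∀ M x {z} → 0# < z → ¬ (∀ t → 0# ≤ t → x + t * z ≤ M)
  unbounded M x {z} 0<z bound with ≤∨> M x
  ... | inj₁ M≤x = <⇒≱ 0<z (≤-by (x≤y⇒0≤y-x (≤-trans (bound 1# 0≤1) M≤x))
    (solve 2 (λ x z → x :- (x :+ :1 :* z) := :0 :- z) refl x z))
  ... | inj₂ x<M = <⇒≱ 0<gap (≤-by (x≤y⇒0≤y-x (bound t (proj₁ 0<t))) (begin
      M - (x + t * z)                          ≡⟨ cong (λ u → M - (x + u)) tz≡ ⟩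
      M - (x + (gap + gap))                    ≡⟨ solve 2 (λ x M → M :- (x :+ ((M :- x) :+ (M :- x))) := :0 :- (M :- x)) refl x M ⟩
      0# - gap                                 ∎))
    where
    open ≡-Reasoning
    gap = M - x
    0<gap = x<y⇒0<y-x x<M
    -- This parameter moves by twice the gap, so the bound `M` is exceeded by exactly the gap.
    t = (gap + gap) * z ⁻¹
    0<t : 0# < t
    0<t = *-positive (<-≤-trans 0<gap (≤-by (proj₁ 0<gap) (solve 1 (λ g → g := (g :+ g) :- g) refl gap))) (⁻¹-positive 0<z)
    tz≡ : t * z ≡ gap + gap
    tz≡ = begin
      (gap + gap) * z ⁻¹ * z    ≡⟨ solve 3 (λ g z z′ → g :* z′ :* z := (z :* z′) :* g) refl (gap + gap) z (z ⁻¹) ⟩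
      z * z ⁻¹ * (gap + gap)    ≡⟨ cong (_* (gap + gap)) (*-inverseʳ z (>⇒≢ 0<z)) ⟩
      1# * (gap + gap)          ≡⟨ *-identityˡ _ ⟩
      gap + gap                 ∎

  module _ {m d : ℕ} (P : Polytope m d) where
    open Polytope P using (nonempty; bounded)

    functional-bounded-below : ∀ r → ∃[ R ] (∀ x → x ∈ᴾ P → - R ≤ r ∙ x)
    functional-bounded-below r with bounded
    ... | M , bound with bounded-below M r
    ...   | R , below = R , λ x x∈P → below x (bound x x∈P)

    -- The ray from a feasible point in direction `z` never leaves P, whereas a nonzero coordinate
    -- of `z` would carry it out of the bounding box. A negative coordinate is treated by negating
    -- the line and using the lower bound.
    no-recession : ∀ z → (∀ i → lookup (A P) i ∙ z ≤ 0#) → z ≡ 𝟎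
    no-recession z recedes with bounded | nonempty
    ... | M , bound | x , x∈P = lookup≡0⇒≡𝟎 z coordinate
      where
      ray : ∀ t → 0# ≤ t → x ⊕ t • z ∈ᴾ P
      ray t 0≤t i = ≤-trans
        (≤-reflexive (trans (∙-⊕ʳ aᵢ x (t • z)) (cong (aᵢ ∙ x +_) (∙-•ʳ t aᵢ z))))
        (≤-by (+-nonNegative (x≤y⇒0≤y-x (x∈P i)) (*-nonNegative 0≤t (neg-nonNegative (recedes i))))
          (solve 4 (λ b ax t az → (b :- ax) :+ t :* (:- az) := b :- (ax :+ t :* az)) refl
            (lookup (b P) i) (aᵢ ∙ x) t (aᵢ ∙ z)))
        where aᵢ = lookup (A P) i

      coordinate : ∀ j → lookup z j ≡ 0#
      coordinate j with ≤∨> (lookup z j) 0# | ≤∨> 0# (lookup z j)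
      ... | inj₂ 0<zⱼ | _ = contradiction
        (λ t 0≤t → subst (_≤ M) (lookup-⊕-• x z t j) (proj₂ (bound _ (ray t 0≤t) j)))
        (unbounded M (lookup x j) 0<zⱼ)
      ... | inj₁ _ | inj₂ zⱼ<0 = contradiction
        (λ t 0≤t → ≤-by
          (x≤y⇒0≤y-x (subst (- M ≤_) (lookup-⊕-• x z t j) (proj₁ (bound _ (ray t 0≤t) j))))
          (solve 4 (λ M xⱼ t zⱼ → (xⱼ :+ t :* zⱼ) :- (:- M) := M :- (:- xⱼ :+ t :* (:0 :- zⱼ)))
            refl M (lookup x j) t (lookup z j)))
        (unbounded M (- lookup x j) (x<y⇒0<y-x zⱼ<0))
      ... | inj₁ zⱼ≤0 | inj₁ 0≤zⱼ = ≤-antisym zⱼ≤0 0≤zⱼ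

    Tight : Vector d → Pred (Fin m) 0ℓ
    Tight x i = lookup (A P) i ∙ x ≡ lookup (b P) i

    -- The ray from u through v stays in P for a while beyond v, and a valid
    -- functional cannot increase along it past its maximum.
    tight-∈ꟳ : ∀ {F : Face P} {u v} → v ∈ꟳ F → u ∈ᴾ P → (∀ i → Tight v i → Tight u i) → u ∈ꟳ F
    tight-∈ꟳ {F} {u} {v} (v∈P , v-max) u∈P tight =
      u∈P , ≤-antisym (valid u u∈P) (from-beyond (ev-witness (ev-∀Fin beyond)))
      where
      open Face F
      open ≡-Reasoning

      past : Carrier → Vector d
      past ε = v ⊕ ε • (v ⊖ u)

      ∙-past : ∀ n ε → n ∙ past ε ≡ n ∙ v + ε * (n ∙ v - n ∙ u)
      ∙-past n ε = begin
        n ∙ past ε                       ≡⟨ ∙-⊕ʳ n v _ ⟩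
        n ∙ v + n ∙ (ε • (v ⊖ u))        ≡⟨ cong (n ∙ v +_) (∙-•ʳ ε n _) ⟩
        n ∙ v + ε * (n ∙ (v ⊖ u))        ≡⟨ cong (λ t → n ∙ v + ε * t) (∙-⊖ʳ n v u) ⟩
        n ∙ v + ε * (n ∙ v - n ∙ u)      ∎

      -- A row tight at `v` is also tight at `u`, hence constant along the ray; any other row has
      -- positive slack at `v`, which a small step does not use up.
      beyond : ∀ i → Eventually (λ ε → lookup (A P) i ∙ past ε ≤ lookup (b P) i)
      beyond i with em {Tight v i}
      ... | yes vᵢ = ev-always λ ε _ → ≤-reflexive (begin
        aᵢ ∙ past ε                       ≡⟨ ∙-past aᵢ ε ⟩
        aᵢ ∙ v + ε * (aᵢ ∙ v - aᵢ ∙ u)    ≡⟨ cong₂ (λ s t → s + ε * (s - t)) vᵢ (tight i vᵢ) ⟩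
        bᵢ + ε * (bᵢ - bᵢ)                ≡⟨ solve 2 (λ b ε → b :+ ε :* (b :- b) := b) refl bᵢ ε ⟩
        bᵢ                                ∎)
        where aᵢ = lookup (A P) i
              bᵢ = lookup (b P) i
      ... | no ¬vᵢ = ev-map
        (λ ε _ small → ≤-trans (≤-reflexive (∙-past aᵢ ε)) (≤-by (x≤y⇒0≤y-x small)
          (solve 3 (λ b av e → (b :- av) :- e := b :- (av :+ e)) refl bᵢ (aᵢ ∙ v) _)))
        (ev-*-≤ (aᵢ ∙ v - aᵢ ∙ u) (x<y⇒0<y-x (v∈P i , ¬vᵢ)))
        where aᵢ = lookup (A P) i
              bᵢ = lookup (b P) i

      -- Validity beyond `v` bounds the increment ε (n·v - n·u) above by 0, so n·u is at least the
      -- maximum n·v.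
      from-beyond : ∃[ ε ] (0# < ε × past ε ∈ᴾ P) → offset ≤ normal ∙ u
      from-beyond (ε , 0<ε , past∈P) = subst (_≤ normal ∙ u) v-max (*-cancelˡ-≤ 0<ε (≤-by
        (x≤y⇒0≤y-x (subst₂ _≤_ (∙-past normal ε) (sym v-max) (valid _ past∈P)))
        (solve 3 (λ nv nu ε → nv :- (nv :+ ε :* (nv :- nu)) := ε :* nu :- ε :* nv) refl
          (normal ∙ v) (normal ∙ u) ε)))

    -- The proof stored in a `Vertex` is irrelevant; since excluded middle decides `IsVertex`, a
    -- usable proof can be recomputed from it.
    isVertex : (v : Vertex P) → IsVertex P (value v)
    isVertex (v , [ p ]) = recompute em p

    vertex-∈ᴾ : (v : Vertex P) → value v ∈ᴾ P
    vertex-∈ᴾ v = proj₁ (Equivalence.from (proj₂ (isVertex v) (value v)) refl)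

    tightRows : Vertex P → Vec Bool m
    tightRows v = tabulate λ i → does (em {Tight (value v) i})

    -- If every row tight at v is tight at u, then `tight-∈ꟳ` places u in the face consisting of v
    -- alone. Hence there are only finitely many vertices, coded by bit vectors as `ev-∀` requires.
    tightRows-injective : ∀ {u v} → tightRows u ≡ tightRows v → u ≡ v
    tightRows-injective {u} {v} eq = value-injective
      (Equivalence.to (proj₂ (isVertex v) (value u))
        (tight-∈ꟳ {F = proj₁ (isVertex v)} (Equivalence.from (proj₂ (isVertex v) (value v)) refl)
          (vertex-∈ᴾ u) tight))
      where
      tight : ∀ i → Tight (value v) i → Tight (value u) i
      tight i vᵢ with em {Tight (value u) i} | em {Tight (value v) i} | sameBit
        where
        sameBit : does (em {Tight (value u) i}) ≡ does (em {Tight (value v) i})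
        sameBit = trans (sym (Vec.lookup∘tabulate _ i))
          (trans (cong (λ s → lookup s i) eq) (Vec.lookup∘tabulate _ i))
      ... | yes uᵢ | _      | _ = uᵢ
      ... | no _   | no ¬vᵢ | _ = contradiction vᵢ ¬vᵢ

    ev-∀Vertex : {Q : Vertex P → Pred Carrier 0ℓ} →
                 (∀ v → Eventually (Q v)) → Eventually (λ ε → ∀ v → Q v ε)
    ev-∀Vertex = ev-∀ tightRows tightRows-injective

    Separates : Vector d → Set
    Separates r = ∀ (u v : Vertex P) → r ∙ value u ≡ r ∙ value v → u ≡ v

    -- Points of the moment curve close to its start serve: the difference of two distinct vertices
    -- is a nonzero coefficient vector, so its polynomial has no small positive root, and only
    -- finitely many pairs occur.
    separating : ∃[ r ] Separates r
    separating = case ev-witness (ev-∀Vertex λ u → ev-∀Vertex λ v → separated u v) of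
      λ { (τ , _ , sep) → powers d τ , sep }
      where
      separated : ∀ u v → Eventually (λ τ → powers d τ ∙ value u ≡ powers d τ ∙ value v → u ≡ v)
      separated u v with em {u ≡ v}
      ... | yes u≡v = ev-always λ _ _ _ → u≡v
      ... | no u≢v  = ev-map
        (λ τ _ p≢0 eq → contradiction
          (trans (∙-⊖ʳ (powers d τ) (value u) (value v))
            (trans (cong (_- powers d τ ∙ value v) eq) (x-x≡0 _))) p≢0)
        (powers-nonzero (value u ⊖ value v) (u≢v ∘ value-injective ∘ x⊖y≡𝟎⇒x≡y _ _))

  -- The projective transformation y = x / (1 + qᵗx), with inverse
  -- x = y / (1 - qᵗy), turns aᵗx ≤ β into (a + β q)ᵗy ≤ β.
  module Projective {m d : ℕ} (P : Polytope m d) (q : Vector d)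
    (1≤2h : ∀ x → x ∈ᴾ P → 1# ≤ 2# * (1# + q ∙ x)) where
    open Polytope P using (nonempty; bounded)

    h s : Vector d → Carrier
    h x = 1# + q ∙ x
    s y = 1# - q ∙ y

    φ ψ : Vector d → Vector d
    φ x = h x ⁻¹ • x
    ψ y = s y ⁻¹ • y

    tilt : Vector d → Carrier → Vector d
    tilt n o = n ⊕ o • q

    A′ : Matrix m d
    A′ = zipWith tilt (A P) (b P)

    lookup-A′ : ∀ i → lookup A′ i ≡ tilt (lookup (A P) i) (lookup (b P) i)
    lookup-A′ i = Vec.lookup-zipWith tilt i (A P) (b P)

    0<h : ∀ {x} → x ∈ᴾ P → 0# < h x
    0<h x∈P = positive-cofactor 0<2 (<-≤-trans 0<1 (1≤2h _ x∈P))

    tilt-∙ : ∀ n o y → tilt n o ∙ y ≡ n ∙ y + o * (q ∙ y)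
    tilt-∙ n o y = trans (∙-⊕ˡ n (o • q) y) (cong (n ∙ y +_) (∙-•ˡ o q y))

    -- `pullFace` tilts a normal by the negated offset and keeps the offset, so this cancellation
    -- makes `pushFace` undo it.
    tilt-untilt : ∀ n o y → tilt (tilt n (- o)) o ∙ y ≡ n ∙ y
    tilt-untilt n o y = begin
      tilt (tilt n (- o)) o ∙ y                  ≡⟨ tilt-∙ (tilt n (- o)) o y ⟩
      tilt n (- o) ∙ y + o * (q ∙ y)             ≡⟨ cong (_+ o * (q ∙ y)) (tilt-∙ n (- o) y) ⟩
      n ∙ y + - o * (q ∙ y) + o * (q ∙ y)        ≡⟨ solve 3 (λ ny o qy → ny :+ :- o :* qy :+ o :* qy := ny) refl (n ∙ y) o (q ∙ y) ⟩
      n ∙ y                                      ∎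
      where open ≡-Reasoning

    module _ {y} (0<s : 0# < s y) where
      open ≡-Reasoning

      s•ψ : s y • ψ y ≡ y
      s•ψ = •-inverseˡ y (*-inverseʳ (s y) (>⇒≢ 0<s))

      ∙-ψ : ∀ n → n ∙ y ≡ s y * (n ∙ ψ y)
      ∙-ψ n = trans (cong (n ∙_) (sym s•ψ)) (∙-•ʳ (s y) n (ψ y))

      -- As `s y` is positive, this identity carries both validity and tightness of inequalities
      -- between `y` and `ψ y`; the four `tilt` lemmas after it are read off from it.
      slack : ∀ n o → o - tilt n o ∙ y ≡ s y * (o - n ∙ ψ y)
      slack n o = begin
        o - tilt n o ∙ y                    ≡⟨ cong (λ t → o - t) (tilt-∙ n o y) ⟩
        o - (n ∙ y + o * (q ∙ y))           ≡⟨ cong (λ t → o - (t + o * (q ∙ y))) (∙-ψ n) ⟩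
        o - (s y * (n ∙ ψ y) + o * (q ∙ y)) ≡⟨ solve 3 (λ o t qy → o :- ((:1 :- qy) :* t :+ o :* qy)
                                                  := (:1 :- qy) :* (o :- t)) refl o (n ∙ ψ y) (q ∙ y) ⟩
        s y * (o - n ∙ ψ y)                 ∎

      tilt-≤⁺ : ∀ n o → n ∙ ψ y ≤ o → tilt n o ∙ y ≤ o
      tilt-≤⁺ n o p = ≤-by (*-nonNegative (proj₁ 0<s) (x≤y⇒0≤y-x p)) (sym (slack n o))

      tilt-≤⁻ : ∀ n o → tilt n o ∙ y ≤ o → n ∙ ψ y ≤ o
      tilt-≤⁻ n o p = 0≤y-x⇒x≤y (*-cancelˡ-≤ 0<s
        (subst₂ _≤_ (sym (zeroʳ (s y))) (slack n o) (x≤y⇒0≤y-x p)))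

      tilt-≡⁺ : ∀ n o → n ∙ ψ y ≡ o → tilt n o ∙ y ≡ o
      tilt-≡⁺ n o p = sym (x-y≡0⇒x≡y (begin
        o - tilt n o ∙ y       ≡⟨ slack n o ⟩
        s y * (o - n ∙ ψ y)    ≡⟨ cong (λ t → s y * (o - t)) p ⟩
        s y * (o - o)          ≡⟨ cong (s y *_) (x-x≡0 o) ⟩
        s y * 0#               ≡⟨ zeroʳ (s y) ⟩
        0#                     ∎))

      tilt-≡⁻ : ∀ n o → tilt n o ∙ y ≡ o → n ∙ ψ y ≡ o
      tilt-≡⁻ n o p = sym (x-y≡0⇒x≡y (*-cancelˡ (>⇒≢ 0<s) (begin
        s y * (o - n ∙ ψ y)    ≡⟨ slack n o ⟨
        o - tilt n o ∙ y       ≡⟨ cong (λ t → o - t) p ⟩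
        o - o                  ≡⟨ x-x≡0 o ⟩
        0#                     ≡⟨ zeroʳ (s y) ⟨
        s y * 0#               ∎)))

      s*h∘ψ : s y * h (ψ y) ≡ 1#
      s*h∘ψ = begin
        s y * (1# + q ∙ ψ y)       ≡⟨ solve 2 (λ s t → s :* (:1 :+ t) := s :+ s :* t) refl (s y) (q ∙ ψ y) ⟩
        s y + s y * (q ∙ ψ y)      ≡⟨ cong (s y +_) (∙-ψ q) ⟨
        (1# - q ∙ y) + q ∙ y       ≡⟨ solve 1 (λ t → (:1 :- t) :+ t := :1) refl (q ∙ y) ⟩
        1#                         ∎

    module _ {x} (x∈P : x ∈ᴾ P) where
      open ≡-Reasoning

      h*h⁻¹ : h x * h x ⁻¹ ≡ 1#
      h*h⁻¹ = *-inverseʳ (h x) (>⇒≢ (0<h x∈P))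

      s∘φ : s (φ x) ≡ h x ⁻¹
      s∘φ = begin
        1# - q ∙ φ x                          ≡⟨ cong (λ t → 1# - t) (∙-•ʳ (h x ⁻¹) q x) ⟩
        1# - h x ⁻¹ * (q ∙ x)                 ≡⟨ cong (λ t → t - h x ⁻¹ * (q ∙ x)) h*h⁻¹ ⟨
        h x * h x ⁻¹ - h x ⁻¹ * (q ∙ x)       ≡⟨ solve 2 (λ t k → (:1 :+ t) :* k :- k :* t := k) refl (q ∙ x) (h x ⁻¹) ⟩
        h x ⁻¹                                ∎

      0<s∘φ : 0# < s (φ x)
      0<s∘φ = subst (0# <_) (sym s∘φ) (⁻¹-positive (0<h x∈P))

      ψ∘φ : ψ (φ x) ≡ x
      ψ∘φ = •-inverseˡ x (begin
        s (φ x) ⁻¹ * h x ⁻¹       ≡⟨ cong (s (φ x) ⁻¹ *_) s∘φ ⟨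
        s (φ x) ⁻¹ * s (φ x)      ≡⟨ *-comm _ _ ⟩
        s (φ x) * s (φ x) ⁻¹      ≡⟨ *-inverseʳ _ (>⇒≢ 0<s∘φ) ⟩
        1#                        ∎)

      φ-feasible : Feasible A′ (b P) (φ x)
      φ-feasible i rewrite lookup-A′ i = tilt-≤⁺ 0<s∘φ (lookup (A P) i) _
        (subst (λ x → lookup (A P) i ∙ x ≤ lookup (b P) i) (sym ψ∘φ) (x∈P i))

    -- Otherwise y - s(y) x₀ would be a recession direction of P.
    feasible⇒0<s : ∀ {y} → Feasible A′ (b P) y → 0# < s y
    feasible⇒0<s {y} y∈ with ≤∨> (s y) 0#
    ... | inj₂ 0<s = 0<s
    ... | inj₁ s≤0 with nonempty
    ...   | x₀ , x₀∈P = contradiction 1≤0 (<⇒≱ 0<1)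
      where
      open ≡-Reasoning
      z = y ⊕ (- s y) • x₀

      ∙-z : ∀ n → n ∙ z ≡ n ∙ y - s y * (n ∙ x₀)
      ∙-z n = begin
        n ∙ z                              ≡⟨ ∙-⊕ʳ n y _ ⟩
        n ∙ y + n ∙ ((- s y) • x₀)         ≡⟨ cong (n ∙ y +_) (∙-•ʳ (- s y) n x₀) ⟩
        n ∙ y + - s y * (n ∙ x₀)           ≡⟨ solve 3 (λ ny s nx → ny :+ :- s :* nx := ny :- s :* nx) refl (n ∙ y) (s y) (n ∙ x₀) ⟩
        n ∙ y - s y * (n ∙ x₀)             ∎

      -- The value - aᵢ·z is the slack of the tilted row at `y` plus the nonnegative factor `- s y`
      -- times the slack of the original row at `x₀`.
      recedes : ∀ i → lookup (A P) i ∙ z ≤ 0#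
      recedes i = ≤-by
        (+-nonNegative (x≤y⇒0≤y-x (subst (_≤ bᵢ) (trans (cong (_∙ y) (lookup-A′ i)) (tilt-∙ aᵢ bᵢ y)) (y∈ i)))
                       (*-nonNegative (neg-nonNegative s≤0) (x≤y⇒0≤y-x (x₀∈P i))))
        (begin
          (bᵢ - (aᵢ ∙ y + bᵢ * (q ∙ y))) + - s y * (bᵢ - aᵢ ∙ x₀)
            ≡⟨ solve 4 (λ b ay qy ax →
                 (b :- (ay :+ b :* qy)) :+ :- (:1 :- qy) :* (b :- ax)
                 := :0 :- (ay :- (:1 :- qy) :* ax)) refl bᵢ (aᵢ ∙ y) (q ∙ y) (aᵢ ∙ x₀) ⟩
          0# - (aᵢ ∙ y - s y * (aᵢ ∙ x₀))
            ≡⟨ cong (λ t → 0# - t) (∙-z aᵢ) ⟨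
          0# - aᵢ ∙ z
            ∎)
        where aᵢ = lookup (A P) i
              bᵢ = lookup (b P) i

      q∙z≡0 : q ∙ y - s y * (q ∙ x₀) ≡ 0#
      q∙z≡0 = trans (sym (∙-z q)) (trans (cong (q ∙_) (no-recession P z recedes)) (∙-𝟎 q))

      -- Since `z` vanishes, the nonnegative product of `- s y` and `h x₀` equals q·z - 1 = -1.
      1≤0 : 1# ≤ 0#
      1≤0 = ≤-by (*-nonNegative (neg-nonNegative s≤0) (proj₁ (0<h x₀∈P))) (begin
        - s y * (1# + q ∙ x₀)                                ≡⟨ solve 2 (λ qy qx →
                                                                  :- (:1 :- qy) :* (:1 :+ qx)
                                                                  := (qy :- (:1 :- qy) :* qx) :- :1)
                                                                  refl (q ∙ y) (q ∙ x₀) ⟩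
        (q ∙ y - s y * (q ∙ x₀)) - 1#                        ≡⟨ cong (_- 1#) q∙z≡0 ⟩
        0# - 1#                                              ∎)

    ψ-feasible : ∀ {y} → Feasible A′ (b P) y → ψ y ∈ᴾ P
    ψ-feasible y∈ i = tilt-≤⁻ (feasible⇒0<s y∈) (lookup (A P) i) _
      (subst (λ a → a ∙ _ ≤ lookup (b P) i) (lookup-A′ i) (y∈ i))

    -- Since `s y` is the reciprocal of `h (ψ y)`, the lower bound 1/2 for `h` on P turns into this
    -- upper bound.
    s≤2 : ∀ {y} → Feasible A′ (b P) y → s y ≤ 2#
    s≤2 {y} y∈ = subst₂ _≤_ (*-identityʳ (s y)) (begin
      s y * (2# * h (ψ y))     ≡⟨ solve 2 (λ s h → s :* (:2 :* h) := :2 :* (s :* h)) refl (s y) (h (ψ y)) ⟩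
      2# * (s y * h (ψ y))     ≡⟨ cong (2# *_) (s*h∘ψ (feasible⇒0<s y∈)) ⟩
      2# * 1#                  ≡⟨ *-identityʳ 2# ⟩
      2#                       ∎)
      (*-monoˡ-≤ (proj₁ (feasible⇒0<s y∈)) (1≤2h (ψ y) (ψ-feasible y∈)))
      where open ≡-Reasoning

    scaled-bounds : ∀ {t M u} → 0# ≤ t → t ≤ 2# → - M ≤ u → u ≤ M →
                    - (2# * M) ≤ t * u × t * u ≤ 2# * M
    scaled-bounds {t} {M} {u} 0≤t t≤2 -M≤u u≤M =
        ≤-trans (≤-by 0≤[2-t]M
            (solve 2 (λ t M → (:2 :- t) :* M := t :* (:- M) :- (:- (:2 :* M))) refl t M))
          (*-monoˡ-≤ 0≤t -M≤u)
      , ≤-trans (*-monoˡ-≤ 0≤t u≤M) (≤-by 0≤[2-t]M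
            (solve 2 (λ t M → (:2 :- t) :* M := :2 :* M :- t :* M) refl t M))
      where
      0≤M : 0# ≤ M
      0≤M = *-cancelˡ-≤ 0<2 (≤-by (x≤y⇒0≤y-x (≤-trans -M≤u u≤M))
        (solve 1 (λ M → M :- (:- M) := :2 :* M :- :2 :* :0) refl M))
      0≤[2-t]M : 0# ≤ (2# - t) * M
      0≤[2-t]M = *-nonNegative (x≤y⇒0≤y-x t≤2) 0≤M

    image : Polytope m d
    image = record
      { A        = A′
      ; b        = b P
      ; nonempty = case nonempty of λ { (x , x∈P) → φ x , φ-feasible x∈P }
      -- A point y of the image is `s y` times the point `ψ y` of P, and the factor is between 0 and
      -- 2, so doubling the box suffices.
      ; bounded  = case bounded of λ { (M , bound) → 2# * M , λ y y∈ j →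
          let 0<s = feasible⇒0<s y∈
              lower , upper = bound (ψ y) (ψ-feasible y∈) j in
          subst (λ t → - (2# * M) ≤ t × t ≤ 2# * M)
            (trans (sym (Vec.lookup-map j (s y *_) (ψ y))) (cong (λ y → lookup y j) (s•ψ 0<s)))
            (scaled-bounds (proj₁ 0<s) (s≤2 y∈) lower upper) }
      }

    -- The scale lost by ψ can be recovered from its value, because `s` is the reciprocal of `h`
    -- after ψ.
    ψ-injective : ∀ {u v} → u ∈ᴾ image → v ∈ᴾ image → ψ u ≡ ψ v → u ≡ v
    ψ-injective {u} {v} u∈ v∈ eq = begin
      u             ≡⟨ s•ψ (feasible⇒0<s u∈) ⟨
      s u • ψ u     ≡⟨ cong₂ _•_ su≡sv eq ⟩
      s v • ψ v     ≡⟨ s•ψ (feasible⇒0<s v∈) ⟩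
      v             ∎
      where
      open ≡-Reasoning
      su≡sv : s u ≡ s v
      su≡sv = *-cancelˡ (>⇒≢ (0<h (ψ-feasible v∈))) (begin
        h (ψ v) * s u    ≡⟨ *-comm _ _ ⟩
        s u * h (ψ v)    ≡⟨ cong (λ x → s u * h x) eq ⟨
        s u * h (ψ u)    ≡⟨ s*h∘ψ (feasible⇒0<s u∈) ⟩
        1#               ≡⟨ s*h∘ψ (feasible⇒0<s v∈) ⟨
        s v * h (ψ v)    ≡⟨ *-comm _ _ ⟩
        h (ψ v) * s v    ∎)

    pushFace : Face P → Face image
    pushFace F = record
      { normal = tilt normal offset
      ; offset = offset
      ; valid  = λ y y∈ → tilt-≤⁺ (feasible⇒0<s y∈) normal offset (valid (ψ y) (ψ-feasible y∈))
      }
      where open Face F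

    pullFace : Face image → Face P
    pullFace G = record
      { normal = tilt normal (- offset)
      ; offset = offset
      ; valid  = λ x x∈P → subst (λ x → tilt normal (- offset) ∙ x ≤ offset) (ψ∘φ x∈P)
          (tilt-≤⁻ (0<s∘φ x∈P) (tilt normal (- offset)) offset
            (subst (_≤ offset) (sym (tilt-untilt normal offset _)) (valid (φ x) (φ-feasible x∈P))))
      }
      where open Face G

    pushFace-∈⁺ : ∀ F {y} → y ∈ᴾ image → ψ y ∈ꟳ F → y ∈ꟳ pushFace F
    pushFace-∈⁺ F y∈ (_ , eq) = y∈ , tilt-≡⁺ (feasible⇒0<s y∈) (Face.normal F) _ eq

    pushFace-∈⁻ : ∀ F {y} → y ∈ꟳ pushFace F → ψ y ∈ꟳ F
    pushFace-∈⁻ F (y∈ , eq) = ψ-feasible y∈ , tilt-≡⁻ (feasible⇒0<s y∈) (Face.normal F) _ eq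

    push-pull : ∀ G → pushFace (pullFace G) ≋ G
    push-pull G = (λ y (y∈ , eq) → y∈ , trans (sym (tilt-untilt (Face.normal G) (Face.offset G) y)) eq) ,
                  (λ y (y∈ , eq) → y∈ , trans (tilt-untilt (Face.normal G) (Face.offset G) y) eq)

    pushFace-mono : ∀ F G → F ⊑ G → pushFace F ⊑ pushFace G
    pushFace-mono F G F⊑G y y∈F@(y∈ , _) = pushFace-∈⁺ G y∈ (F⊑G (ψ y) (pushFace-∈⁻ F y∈F))

    pushFace-cancel : ∀ F G → pushFace F ⊑ pushFace G → F ⊑ G
    pushFace-cancel F G F⊑G x x∈F@(x∈P , _) = subst (_∈ꟳ G) (ψ∘φ x∈P)
      (pushFace-∈⁻ G (F⊑G (φ x) (pushFace-∈⁺ F (φ-feasible x∈P) (subst (_∈ꟳ F) (sym (ψ∘φ x∈P)) x∈F))))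

    -- For y in the image, y lies in `pushFace F` exactly when `ψ y` lies in `F`. As ψ reaches every
    -- point of P, inclusions are both preserved and reflected.
    combinatorially-isomorphic : P ≅ image
    combinatorially-isomorphic = pushFace , record
      { isOrderMonomorphism = record
        { isOrderHomomorphism = record
          { cong = λ {F} {G} (p , q) → pushFace-mono F G p , pushFace-mono G F q
          ; mono = λ {F} {G} → pushFace-mono F G
          }
        ; injective = λ {F} {G} (p , q) → pushFace-cancel F G p , pushFace-cancel G F q
        ; cancel    = λ {F} {G} → pushFace-cancel F G
        }
      ; surjective = λ G → pullFace G , λ {F} (p , q) →
          (λ y → proj₁ (push-pull G) y ∘ pushFace-mono F (pullFace G) p y) ,
          (λ y → pushFace-mono (pullFace G) F q y ∘ proj₂ (push-pull G) y)
      }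

    -- The singleton face at y is pulled back: if x lies in the result, then φ x lies in the
    -- singleton, so φ x = y and x = ψ y.
    pullVertex : Vertex image → Vertex P
    pullVertex v@(y , _) = ψ y , [ pullFace G , (λ x → mk⇔ (to x) (from x)) ]
      where
      G = proj₁ (isVertex image v)
      G-v = proj₂ (isVertex image v)
      to : ∀ x → x ∈ꟳ pullFace G → x ≡ ψ y
      to x x∈F@(x∈P , _) = trans (sym (ψ∘φ x∈P)) (cong ψ (Equivalence.to (G-v (φ x))
        (proj₁ (push-pull G) (φ x) (pushFace-∈⁺ (pullFace G) (φ-feasible x∈P)
          (subst (_∈ꟳ pullFace G) (sym (ψ∘φ x∈P)) x∈F)))))
      from : ∀ x → x ≡ ψ y → x ∈ꟳ pullFace G
      from _ refl = pushFace-∈⁻ (pullFace G) (proj₂ (push-pull G) y (Equivalence.from (G-v y) refl))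

    pullVertex-injective : ∀ {u v} → pullVertex u ≡ pullVertex v → u ≡ v
    pullVertex-injective {u} {v} eq =
      value-injective (ψ-injective (vertex-∈ᴾ image u) (vertex-∈ᴾ image v) (cong value eq))

  -- Small projective perturbations with distinct edge vectors.

  module _ {m d : ℕ} (P : Polytope m d) where

    -- All ordered pairs of vertices are compared, diagonals as well as edges. The condition `u ≢ v`
    -- excludes the zero vector, which is the difference of every vertex with itself.
    DistinctEdgeVectors : Set
    DistinctEdgeVectors = ∀ (v u v′ u′ : Vertex P) → u ≢ v →
      value u ⊖ value v ≡ value u′ ⊖ value v′ → v ≡ v′ × u ≡ u′

    module _ (r : Vector d) where

      -- The first condition is what `Projective` asks of q = ε r; the second is the conclusion of
      -- `reciprocals-Sidon`, for all quadruples of vertices at once.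
      GoodScale : Carrier → Set
      GoodScale ε =
        (∀ x → x ∈ᴾ P → 1# ≤ 2# * (1# + (ε • r) ∙ x)) ×
        (∀ (v₁ v₂ v₃ v₄ : Vertex P) → let a = λ v → r ∙ value v in ∀ s₁ s₂ s₃ s₄ →
          s₁ * (1# + ε * a v₁) ≡ 1# → s₂ * (1# + ε * a v₂) ≡ 1# →
          s₃ * (1# + ε * a v₃) ≡ 1# → s₄ * (1# + ε * a v₄) ≡ 1# →
          s₁ + s₂ ≡ s₃ + s₄ → (a v₁ ≡ a v₃ × a v₂ ≡ a v₄) ⊎ (a v₁ ≡ a v₄ × a v₂ ≡ a v₃))

      ev-GoodScale : Eventually GoodScale
      ev-GoodScale = ev-×
        -- With r·x ≥ - `R` on P, 2 h(x) - 1 = (1 - 2 ε `R`) + 2 ε (r·x + `R`) is nonnegative once 2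
        -- ε `R` ≤ 1.
        (case functional-bounded-below P r of λ { (R , below) → ev-map
          (λ ε 0<ε 2εR≤1 x x∈P → ≤-by
            (+-nonNegative (x≤y⇒0≤y-x 2εR≤1)
              (*-nonNegative (proj₁ (*-positive 0<2 0<ε)) (x≤y⇒0≤y-x (below x x∈P))))
            (trans
              (solve 3 (λ ε R rx →
                (:1 :- ε :* (:2 :* R)) :+ :2 :* ε :* (rx :- (:- R))
                := :2 :* (:1 :+ ε :* rx) :- :1) refl ε R (r ∙ x))
              (cong (λ t → 2# * (1# + t) - 1#) (sym (∙-•ˡ ε r x)))))
          (ev-*-≤ (2# * R) 0<1) })
        (ev-∀Vertex P λ v₁ → ev-∀Vertex P λ v₂ → ev-∀Vertex P λ v₃ → ev-∀Vertex P λ v₄ →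
          reciprocals-Sidon (r ∙ value v₁) (r ∙ value v₂) (r ∙ value v₃) (r ∙ value v₄))

    -- Row i moves by ε bᵢ r, so each of the finitely many entries changes by a fixed multiple of ε.
    -- Applying `ev-*-≤` to that multiple and to its negative gives the two sides of `Within`.
    ev-perturbation : ∀ (r : Vector d) {δ} → 0# < δ → Eventually (λ ε → ∀ i j →
      Within δ (lookup (lookup (A P) i ⊕ lookup (b P) i • (ε • r)) j) (lookup (lookup (A P) i) j))
    ev-perturbation r {δ} 0<δ = ev-∀Fin λ i → ev-∀Fin λ j → within i j
      where
      within : ∀ i j → Eventually (λ ε →
        Within δ (lookup (lookup (A P) i ⊕ lookup (b P) i • (ε • r)) j) (lookup (lookup (A P) i) j))
      within i j = ev-map
        (λ ε 0<ε (upper , lower) → subst (λ t → Within δ t a) (sym (entry ε))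
          ( ≤-by (x≤y⇒0≤y-x upper) (solve 3 (λ δ a e → δ :- e := (a :+ δ) :- (a :+ e)) refl δ a (ε * x))
          , ≤-by (x≤y⇒0≤y-x lower) (solve 4 (λ δ a ε x → δ :- ε :* (:- x) := (a :+ ε :* x) :+ δ :- a) refl δ a ε x)))
        (ev-× (ev-*-≤ x 0<δ) (ev-*-≤ (- x) 0<δ))
        where
        a = lookup (lookup (A P) i) j
        x = lookup (b P) i * lookup r j
        entry : ∀ ε → lookup (lookup (A P) i ⊕ lookup (b P) i • (ε • r)) j ≡ a + ε * x
        entry ε = trans (lookup-⊕-• (lookup (A P) i) (ε • r) (lookup (b P) i) j)
          (cong (a +_) (trans (cong (lookup (b P) i *_) (Vec.lookup-map j (ε *_) r))
            (solve 3 (λ β ε t → β :* (ε :* t) := ε :* (β :* t)) refl (lookup (b P) i) ε (lookup r j))))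

  module _ {m d : ℕ} (P : Polytope m d) (r : Vector d) (ε : Carrier) (good : GoodScale P r ε) where
    open Projective P (ε • r) (proj₁ good)

    -- Equal vectors give u + v′ = u′ + v, and the affine function `s` turns this into an equation
    -- between sums of two reciprocals. Of the two possible pairings, the one matching u with v
    -- contradicts `u ≢ v`.
    image-distinctEdgeVectors : Separates P r → DistinctEdgeVectors image
    image-distinctEdgeVectors separates v u v′ u′ u≢v eq =
      case proj₂ good (p u) (p v′) (p u′) (p v) _ _ _ _ (s∙h u) (s∙h v′) (s∙h u′) (s∙h v) sum≡ of λ where
        (inj₁ (u≡u′ , v′≡v)) → sym (same v′≡v) , same u≡u′
        (inj₂ (u≡v , _))     → contradiction (same u≡v) u≢v
      where
      open ≡-Reasoning
      q = ε • r
      p = pullVertex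
      same : ∀ {w w′} → r ∙ value (p w) ≡ r ∙ value (p w′) → w ≡ w′
      same = pullVertex-injective ∘ separates _ _

      s∙h : ∀ w → s (value w) * (1# + ε * (r ∙ value (p w))) ≡ 1#
      s∙h w = trans (cong (λ t → s (value w) * (1# + t)) (sym (∙-•ˡ ε r (ψ (value w)))))
        (s*h∘ψ (feasible⇒0<s (vertex-∈ᴾ image w)))

      sum≡ : s (value u) + s (value v′) ≡ s (value u′) + s (value v)
      sum≡ = x-y≡0⇒x≡y (begin
        s (value u) + s (value v′) - (s (value u′) + s (value v))
          ≡⟨ solve 4 (λ u v u′ v′ →
               (:1 :- u) :+ (:1 :- v′) :- ((:1 :- u′) :+ (:1 :- v)) := (u′ :- v′) :- (u :- v))
               refl (q ∙ value u) (q ∙ value v) (q ∙ value u′) (q ∙ value v′) ⟩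
        (q ∙ value u′ - q ∙ value v′) - (q ∙ value u - q ∙ value v)
          ≡⟨ cong₂ _-_ (∙-⊖ʳ q _ _) (∙-⊖ʳ q _ _) ⟨
        q ∙ (value u′ ⊖ value v′) - q ∙ (value u ⊖ value v)
          ≡⟨ cong (λ x → q ∙ (value u′ ⊖ value v′) - q ∙ x) eq ⟩
        q ∙ (value u′ ⊖ value v′) - q ∙ (value u′ ⊖ value v′)
          ≡⟨ x-x≡0 _ ⟩
        0#
          ∎)

    image-perturbation : ∀ {δ} → 0# < δ →
      (∀ i j → Within δ (lookup (lookup (A P) i ⊕ lookup (b P) i • (ε • r)) j) (lookup (lookup (A P) i) j)) →
      Perturbation δ P image
    image-perturbation {δ} 0<δ within =
      (λ i j → subst (λ a → Within δ (lookup a j) (lookup (lookup (A P) i) j)) (sym (lookup-A′ i)) (within i j)) ,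
      (λ _ → unchanged , unchanged)
      where
      unchanged : ∀ {x} → x ≤ x + δ
      unchanged {x} = ≤-by (proj₁ 0<δ) (solve 2 (λ x δ → δ := (x :+ δ) :- x) refl x δ)

  -- Normalizations that produce a given arborescence.

  module _ {m d : ℕ} (P : Polytope m d) (c : Vector d) where

    Nb⇒¬IsOptimal : ∀ {v u} → Nb P c v u → ¬ IsOptimal P c v
    Nb⇒¬IsOptimal {u = u} (_ , cv<cu) optimal = <⇒≱ cv<cu (optimal (value u) (vertex-∈ᴾ P u))

    -- An NW-rule also needs a value at linear programs where two edges share
    -- their edge vector.
    separatingWeight : NormalizedWeight P c
    separatingWeight = case separating P of λ { (r , separates) → record
      { η         = λ _ → 1#
      ; w         = r
      ; η-nonzero = λ _ _ _ → >⇒≢ 0<1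
      ; no-ties   = λ v u u′ (nb , max) (nb′ , max′) → separates u u′
          (x-y≡0⇒x≡y (begin
            r ∙ value u - r ∙ value u′
              ≡⟨ solve 3 (λ u u′ v → u :- u′ := (u :- v) :- (u′ :- v)) refl (r ∙ value u) (r ∙ value u′) (r ∙ value v) ⟩
            (r ∙ value u - r ∙ value v) - (r ∙ value u′ - r ∙ value v)
              ≡⟨ cong₂ _-_ (∙-⊖ʳ r _ _) (∙-⊖ʳ r _ _) ⟨
            r ∙ (value u ⊖ value v) - r ∙ (value u′ ⊖ value v)
              ≡⟨ cong (_- r ∙ (value u′ ⊖ value v)) (÷1-cancel (≤-antisym (max′ u nb) (max u′ nb′))) ⟩
            r ∙ (value u′ ⊖ value v) - r ∙ (value u′ ⊖ value v)
              ≡⟨ x-x≡0 _ ⟩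
            0#
              ∎))
      } }
      where
      open ≡-Reasoning
      ÷1-cancel : ∀ {x y} → x ÷ 1# ≡ y ÷ 1# → x ≡ y
      ÷1-cancel {x} {y} eq = *-cancelˡ (>⇒≢ (⁻¹-positive 0<1)) (begin
        1# ⁻¹ * x    ≡⟨ *-comm _ _ ⟩
        x ÷ 1#       ≡⟨ eq ⟩
        y ÷ 1#       ≡⟨ *-comm _ _ ⟩
        1# ⁻¹ * y    ∎)

    module _ (distinct : DistinctEdgeVectors P) (𝒜 : Arborescence P c) where
      open Arborescence 𝒜
      open ≡-Reasoning

      -- This is a predicate on vectors because a normalization sees only the difference u - v;
      -- `distinct` recovers the edge from it.
      Chosen : Pred (Vector d) 0ℓ
      Chosen x = ∃[ v ] (¬ IsOptimal P c v × x ≡ value (next v) ⊖ value v)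

      score : ∀ {x} → Dec (Chosen x) → Carrier
      score (yes _) = 2#
      score (no _)  = 1#

      0<score : ∀ {x} (chosen? : Dec (Chosen x)) → 0# < score chosen?
      0<score (yes _) = 0<2
      0<score (no _)  = 0<1

      -- `κ` is the value that the quotient is meant to take, and `η` is obtained by solving (c·x) /
      -- η(x) = κ(x).
      κ η : Vector d → Carrier
      κ x = score (em {Chosen x})
      η x = (c ∙ x) ÷ κ x

      κ≤2 : ∀ x → κ x ≤ 2#
      κ≤2 x with em {Chosen x}
      ... | yes _ = ≤-refl
      ... | no _  = proj₁ 1<2

      2≤κ⇒Chosen : ∀ x → 2# ≤ κ x → Chosen x
      2≤κ⇒Chosen x 2≤κ with em {Chosen x}
      ... | yes chosen = chosen
      ... | no _       = contradiction 2≤κ (<⇒≱ 1<2)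

      Chosen⇒κ≡2 : ∀ x → Chosen x → κ x ≡ 2#
      Chosen⇒κ≡2 x chosen with em {Chosen x}
      ... | yes _      = refl
      ... | no ¬chosen = contradiction chosen ¬chosen

      η-nonzero : ∀ v u → Nb P c v u → η (value u ⊖ value v) ≢ 0#
      η-nonzero v u (_ , cv<cu) = *-≢0
        (λ eq → >⇒≢ (x<y⇒0<y-x cv<cu) (trans (sym (∙-⊖ʳ c _ _)) eq))
        (>⇒≢ (⁻¹-positive (0<score em)))

      ratio≡κ : ∀ v u → Nb P c v u → ratio P c η c v u ≡ κ (value u ⊖ value v)
      ratio≡κ v u nb = begin
        (c ∙ x) * η x ⁻¹                   ≡⟨ cong (_* η x ⁻¹) c∙x≡ ⟩
        η x * κ x * η x ⁻¹                 ≡⟨ solve 3 (λ η κ η′ → η :* κ :* η′ := (η :* η′) :* κ) refl (η x) (κ x) (η x ⁻¹) ⟩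
        η x * η x ⁻¹ * κ x                 ≡⟨ cong (_* κ x) (*-inverseʳ (η x) (η-nonzero v u nb)) ⟩
        1# * κ x                           ≡⟨ *-identityˡ (κ x) ⟩
        κ x                                ∎
        where
        x = value u ⊖ value v
        c∙x≡ : c ∙ x ≡ (c ∙ x) ÷ κ x * κ x
        c∙x≡ = begin
          c ∙ x                       ≡⟨ *-identityʳ _ ⟨
          (c ∙ x) * 1#                ≡⟨ cong ((c ∙ x) *_) (*-inverseʳ (κ x) (>⇒≢ (0<score em))) ⟨
          (c ∙ x) * (κ x * κ x ⁻¹)    ≡⟨ solve 3 (λ t κ κ′ → t :* (κ :* κ′) := t :* κ′ :* κ) refl (c ∙ x) (κ x) (κ x ⁻¹) ⟩
          (c ∙ x) ÷ κ x * κ x         ∎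

      next-ratio : ∀ v → ¬ IsOptimal P c v → ratio P c η c v (next v) ≡ 2#
      next-ratio v ¬optimal = trans (ratio≡κ v (next v) (improving v ¬optimal))
        (Chosen⇒κ≡2 _ (v , ¬optimal , refl))

      next-IsArgmax : ∀ v → ¬ IsOptimal P c v → IsArgmax P c η c v (next v)
      next-IsArgmax v ¬optimal = improving v ¬optimal , λ u nb →
        subst₂ _≤_ (sym (ratio≡κ v u nb)) (sym (next-ratio v ¬optimal)) (κ≤2 _)

      -- A maximizer has quotient at least 2, so its edge vector is that of some chosen edge
      -- starting at a vertex `v′`; distinctness forces `v′` = `v` and identifies the endpoints.
      IsArgmax⇒≡next : ∀ v u → IsArgmax P c η c v u → u ≡ next v
      IsArgmax⇒≡next v u (nb@((u≢v , _) , _) , max) =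
        case 2≤κ⇒Chosen _ (subst₂ _≤_ (next-ratio v ¬optimal) (ratio≡κ v u nb) (max _ (improving v ¬optimal))) of
          λ { (v′ , _ , eq) → case distinct v u v′ (next v′) u≢v eq of λ { (refl , u≡) → u≡ } }
        where ¬optimal = Nb⇒¬IsOptimal nb

      arborescenceWeight : NormalizedWeight P c
      arborescenceWeight = record
        { η         = η
        ; w         = c
        ; η-nonzero = η-nonzero
        ; no-ties   = λ v u u′ max max′ → trans (IsArgmax⇒≡next v u max) (sym (IsArgmax⇒≡next v u′ max′))
        }

      arborescenceWeight-produces : Produces P c arborescenceWeight 𝒜
      arborescenceWeight-produces v = Equivalence.from (fixed v) , next-IsArgmax v

    -- The decision is an argument, so that the proof below can split on it while the rule itself
    -- supplies excluded middle for every polytope.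
    weightFor : Dec (DistinctEdgeVectors P) → Arborescence P c → NormalizedWeight P c
    weightFor (yes distinct) 𝒜 = arborescenceWeight distinct 𝒜
    weightFor (no _)         𝒜 = separatingWeight

    weightFor-produces : DistinctEdgeVectors P → (dec : Dec (DistinctEdgeVectors P)) (𝒜 : Arborescence P c) →
                         Produces P c (weightFor dec 𝒜) 𝒜
    weightFor-produces _        (yes distinct) 𝒜 = arborescenceWeight-produces distinct 𝒜
    weightFor-produces distinct (no ¬distinct) 𝒜 = contradiction distinct ¬distinct

  -- Realising memory-less rules on the perturbed polytope.

  rules-realised : ∀ {m d} (P′ : Polytope m d) → DistinctEdgeVectors P′ →
    (ρ : MemorylessRule) → Σ[ ν ∈ NWRule ]
      ((c : Vector d) (g : Generic P′ c) → Produces P′ c (ν P′ c g) (ρ P′ c g))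
  rules-realised P′ distinct ρ =
    (λ Q c g → weightFor Q c em (ρ Q c g)) ,
    (λ c g → weightFor-produces P′ c distinct em (ρ P′ c g))

  perturbation-with-distinctEdgeVectors : ∀ {m d} (P : Polytope m d) {δ} → 0# < δ →
    Σ[ P′ ∈ Polytope m d ] (Perturbation δ P P′ × P ≅ P′ × DistinctEdgeVectors P′)
  perturbation-with-distinctEdgeVectors P 0<δ = case separating P of λ { (r , separates) →
    -- Closeness to P and `GoodScale` both hold for all small ε, so one value of ε meets both.
    case ev-witness (ev-× (ev-GoodScale P r) (ev-perturbation P r 0<δ)) of λ { (ε , _ , good , within) →
      Projective.image P (ε • r) (proj₁ good) ,
      image-perturbation P r ε good 0<δ within ,
      Projective.combinatorially-isomorphic P (ε • r) (proj₁ good) ,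
      image-distinctEdgeVectors P r ε good separates } }

theorem1p2 : ExcludedMiddle 0ℓ → (ℝ : Reals) →
    let open Reals ℝ
        open LinearProgramming ℝ in
    (m d : ℕ) (P : Polytope m d) → Simple P →
    (δ : Carrier) → 0# < δ →
    Σ[ P′ ∈ Polytope m d ] (Perturbation δ P P′ × P ≅ P′ ×
      ((ρ : MemorylessRule) → Σ[ ν ∈ NWRule ]
        ((c : Vector d) (g : Generic P′ c) →
          Produces P′ c (ν P′ c g) (ρ P′ c g))))
theorem1p2 em ℝ m d P _ δ 0<δ =
  case Polytopes.perturbation-with-distinctEdgeVectors em ℝ P 0<δ of
    λ { (P′ , perturbation , isomorphism , distinct) →
      P′ , perturbation , isomorphism , Polytopes.rules-realised em ℝ P′ distinct }
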